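{- Let $m\ge4$ and let $F\neq[2^m]$ be a bipartite $2$-regular digraph of order $2m$. There exists an admissible $F$-decomposition of $J^*_{2m}$.
   Context: A $2$-regular digraph $[m_1^{\alpha_1},\ldots,m_t^{\alpha_t}]$ is a vertex-disjoint union of directed cycles, $\alpha_i$ of length $m_i$ (each length $\ge2$; a directed $2$-cycle on $\{u,v\}$ has arcs $uv,vu$); it is bipartite if all cycle lengths are even, and $[2^m]$ denotes $m$ disjoint directed $2$-cycles. For a graph $G$, $G^*$ replaces each edge $\{u,v\}$ by arcs $uv,vu$. $J_{2m}$ has vertex set $\{x_i,y_i: 0\le i\le m+1\}$ and edges $\{x_i,y_i\}$ ($1\le i\le m$) and $\{x_i,x_{i+1}\},\{y_i,y_{i+1}\},\{x_i,y_{i+1}\},\{y_i,x_{i+1}\},\{x_i,x_{i+2}\},\{y_i,y_{i+2}\},\{x_i,y_{i+2}\},\{y_i,x_{i+2}\}$ ($0\le i\le m-1$). An admissible $2$-regular subdigraph of $J^*_{2m}$ is a $2$-regular subdigraph of order $2m$ containing exactly one vertex of each of $\{x_0,x_m\},\{x_1,x_{m+1}\},\{y_0,y_m\},\{y_1,y_{m+1}\}$. An admissible $F$-decomposition of $J^*_{2m}$ is a partition of $A(J^*_{2m})$ into admissible $2$-regular subdigraphs each isomorphic to $F$. -}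

module Defs where

open import Data.Bool using (Bool; true; false)
open import Data.Nat using (ℕ; zero; suc; _+_; _*_; _∸_; _≤_; _<_; _<ᵇ_; s≤s; z≤n)
open import Data.Bool using (if_then_else_)
open import Data.Fin using (Fin; toℕ; fromℕ<)
open import Data.Product using (Σ; ∃; _×_; _,_)
open import Data.Sum using (_⊎_)
open import Data.List using (List; []; _∷_)
open import Relation.Binary.PropositionalEquality using (_≡_; _≢_)
open import Relation.Nullary using (¬_)

-- The graph J_{2m}.
-- Vertices: (false , i) = x_i and (true , i) = y_i, for 0 ≤ i ≤ m+1.

Vtx : ℕ → Set
Vtx m = Bool × Fin (suc (suc m))

JEdge : (m : ℕ) → Vtx m → Vtx m → Set
JEdge m (a , i) (b , j) =
    (toℕ i ≡ toℕ j × 1 ≤ toℕ i × toℕ i ≤ m × a ≢ b)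
  ⊎ (toℕ j ≡ suc (toℕ i) × toℕ i < m)
  ⊎ (toℕ j ≡ suc (suc (toℕ i)) × toℕ i < m)

JArc : (m : ℕ) → Vtx m → Vtx m → Set
JArc m u v = JEdge m u v ⊎ JEdge m v u

-- The 2-regular digraph F = [l_1, ..., l_t] (list of cycle lengths),
-- realised on vertex set {0, ..., l_1 + ... + l_t - 1}: the k-th block of
-- l_k consecutive positions forms a directed cycle p ↦ p+1 (last ↦ first).

sumL : List ℕ → ℕ
sumL [] = 0
sumL (l ∷ ls) = l + sumL ls

succF : List ℕ → ℕ → ℕ
succF [] p = p
succF (l ∷ ls) p =
  if p <ᵇ l then (if suc p <ᵇ l then suc p else 0)
            else l + succF ls (p ∸ l)

-- A copy of F in J*_{2m}: an injective map φ from V(F) = {0..n-1} into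
-- V(J_{2m}) sending every arc p → succF p of F to an arc of J*_{2m}.
-- Its image (vertices φ p, arcs φ p → φ (succF p)) is a 2-regular
-- subdigraph of J*_{2m} isomorphic to F, and every such subdigraph arises so.

InImage : (m n : ℕ) → (ℕ → Vtx m) → Vtx m → Set
InImage m n φ v = Σ ℕ λ p → p < n × φ p ≡ v

ExactlyOne : Set → Set → Set
ExactlyOne A B = (A × ¬ B) ⊎ (¬ A × B)

IsCopy : (m : ℕ) → List ℕ → (ℕ → Vtx m) → Set
IsCopy m ls φ =
    (∀ p q → p < sumL ls → q < sumL ls → φ p ≡ φ q → p ≡ q)
  × (∀ p → p < sumL ls → JArc m (φ p) (φ (succF ls p)))

-- Admissible: the vertex set contains exactly one vertex of each of
-- {x_0,x_m}, {x_1,x_{m+1}}, {y_0,y_m}, {y_1,y_{m+1}}.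
-- (Order 2m is enforced by sumL ls ≡ 2 * m in the theorem.)
Admissible : (m : ℕ) → List ℕ → (ℕ → Vtx m) → Set
Admissible m ls φ =
    ExactlyOne (I (false , fromℕ< z0)) (I (false , fromℕ< zm))
  × ExactlyOne (I (false , fromℕ< z1)) (I (false , fromℕ< zm1))
  × ExactlyOne (I (true  , fromℕ< z0)) (I (true  , fromℕ< zm))
  × ExactlyOne (I (true  , fromℕ< z1)) (I (true  , fromℕ< zm1))
  where
    I = InImage m (sumL ls) φ
    open import Data.Nat.Properties using (n<1+n; m≤n⇒m≤1+n)
    z0 : 0 < suc (suc m)
    z0 = s≤s z≤n
    z1 : 1 < suc (suc m)
    z1 = s≤s (s≤s z≤n)
    zm : m < suc (suc m)
    zm = m≤n⇒m≤1+n (n<1+n m)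
    zm1 : suc m < suc (suc m)
    zm1 = n<1+n (suc m)

AdmissibleDecomposition : (m : ℕ) → List ℕ → Set
AdmissibleDecomposition m ls =
  Σ ℕ λ k → Σ (Fin k → ℕ → Vtx m) λ φ →
      (∀ j → IsCopy m ls (φ j) × Admissible m ls (φ j))
    × (∀ u v → JArc m u v →
         Σ (Fin k × ℕ) λ { (j , p) →
             (p < sumL ls × φ j p ≡ u × φ j (succF ls p) ≡ v)
           × (∀ j′ p′ → p′ < sumL ls → φ j′ p′ ≡ u → φ j′ (succF ls p′) ≡ v
                 → j′ ≡ j × p′ ≡ p) })

{-# OPTIONS --safe #-}

-- J_{2m} is a chain of m translates of one unit of 9 edges; it has 18m arcs, so a decomposition
-- consists of 9 factors.  Fix, for each j, the vertices of columns 0 and 1 that the j-th factor omits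
-- (it must then contain their translates in columns m and m+1).  Decompositions of J_{2m} and J_{2n}
-- with the same choice glue to one of J_{2(m+n)}.  Computer search finds a choice for which enough
-- pieces exist: writing k for the cycle length 2k, these are a few lists of 1's and 2's, and the lists
-- {k} ∪ r for all k ≥ 3 and r among ∅, {1}, {1,1}, {2}.  Every list of positive numbers with sum at
-- least 3 is a union of such lists.  The infinite families come from pumping: the long cycles of all
-- nine factors can be made to follow a pattern of period two columns, one more period of which adds 4
-- to the length of each.

module Submission where

open import Defs
open import Data.Bool using (Bool; true; false; T; if_then_else_)
import Data.Bool.Properties as Bool
open import Data.Empty using (⊥-elim)
open import Data.Fin using (Fin; zero; suc; toℕ; fromℕ<)
open import Data.Fin.Properties using (toℕ-fromℕ<; all?)
open import Data.List
  using (List; []; _∷_; _++_; [_]; map; concat; concatMap; length; allFin; applyUpTo)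
open import Data.List.Properties
  using ( map-++; map-∘; map-cong; map-id; ++-assoc; ++-identityʳ; length-map; length-++
        ; concat-++; concat-map; concatMap-++; map-concatMap; concatMap-cong; concatMap-map )
open import Data.List.Membership.Propositional using (_∈_; _∉_)
open import Data.List.Membership.Propositional.Properties
  using (∈-∃++; ∈-++⁺ˡ; ∈-++⁺ʳ; ∈-++⁻; ∈-map⁺; ∈-map⁻; ∈-applyUpTo⁺; ∈-applyUpTo⁻; ∈-allFin)
import Data.List.Membership.DecPropositional as DecMembership
open import Data.List.Relation.Binary.Disjoint.Propositional using (Disjoint)
open import Data.List.Relation.Binary.Permutation.Propositional
  using (_↭_; ↭-refl; ↭-sym; ↭-trans; ↭-reflexive; prep; swap; ↭⇒↭ₛ; module PermutationReasoning)
open import Data.List.Relation.Binary.Permutation.Propositional.Properties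
  using ( ∈-resp-↭; ¬x∷xs↭[]; drop-∷; shift; shifts; ++⁺; ++⁺ˡ; ++⁺ʳ; ++-comm; ↭-length; ↭-map-inv )
  renaming (map⁺ to ↭-map⁺)
import Data.List.Relation.Binary.Permutation.Setoid.Properties as Permutationₛ
open import Data.List.Relation.Unary.All as All using (All; []; _∷_)
import Data.List.Relation.Unary.All.Properties as All
open import Data.List.Relation.Unary.AllPairs using ([]; _∷_)
open import Data.List.Relation.Unary.Any using (here; there)
open import Data.List.Relation.Unary.Unique.Propositional using (Unique)
import Data.List.Relation.Unary.Unique.Propositional.Properties as Unique
open import Data.List.Relation.Unary.Unique.DecPropositional using (unique?)
open import Data.Nat using (ℕ; zero; suc; _+_; _*_; _≤_; _<_; _<ᵇ_; z≤n; s≤s)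
open import Data.Nat.Divisibility using (_∣_; divides)
open import Data.Nat.ListAction using (sum)
open import Data.Nat.ListAction.Properties using (sum-++; sum-↭)
import Data.Nat.Properties as ℕ
open import Data.Product using (Σ; ∃; _×_; _,_; proj₁; proj₂)
open import Data.Product.Properties using (≡-dec)
open import Data.Sum as Sum using (_⊎_; inj₁; inj₂)
open import Data.Vec as Vec using (Vec; []; _∷_; lookup)
open import Relation.Binary using (DecidableEquality)
open import Relation.Binary.PropositionalEquality
  using (_≡_; _≢_; refl; sym; trans; cong; cong₂; subst; subst₂; setoid; module ≡-Reasoning)
open import Relation.Nullary using (¬_; Dec; yes; no; ¬?; _×-dec_)
open import Relation.Nullary.Decidable using (map′; True; toWitness; from-yes)

-- Degrees constrain the choice. In J* a vertex of columns 2 to m-1 has out-degree 9 and so lies in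
-- every factor; the vertices of column 0 have out-degree 4 and those of column 1 out-degree 7.
-- Hence each of x_0, y_0 is omitted by five factors and each of x_1, y_1 by two, in accordance with
-- the out-degrees 5 and 2 in columns m and m+1. The lists to be realised directly are those of sum
-- at least 3 that do not split into two lists of sum at least 3. With ones and twos only, these are
-- all lists of sum 3, 4 or 5, and 2, 2, 2; with an entry k of at least 3, the other entries have
-- sum at most 2. Gluing never merges cycles, so finitely many pieces cannot yield arbitrarily long
-- cycles; hence the pumping. Every condition is an equality of multisets, written as a permutation
-- of lists. Such equalities can be evaluated for the tables and added under gluing, and since the
-- vertices and arcs of J* are listed without repetition, disjointness and exact covering come out
-- of them at the end.

private variable
  I X : Set

-- Deciding equality of multisets

module _ {X : Set} (_≟_ : DecidableEquality X) where

  extract : (v : X) (ys : List X) → Dec (∃ λ zs → v ∷ zs ↭ ys)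
  extract v [] = no λ (_ , p) → ¬x∷xs↭[] p
  extract v (y ∷ ys) with v ≟ y
  ... | yes refl = yes (ys , ↭-refl)
  ... | no v≢y = map′ (λ (zs , p) → y ∷ zs , ↭-trans (swap v y ↭-refl) (prep y p)) later (extract v ys)
    where
    later : (∃ λ zs → v ∷ zs ↭ y ∷ ys) → ∃ λ zs → v ∷ zs ↭ ys
    later (zs , p) with ∈-resp-↭ p (here refl)
    ... | here v≡y = ⊥-elim (v≢y v≡y)
    ... | there v∈ys with ∈-∃++ v∈ys
    ...   | as , bs , refl = as ++ bs , ↭-sym (shift v as bs)

  infix 4 _↭?_
  -- Any occurrence of `v` serves equally well, because a common head can be cancelled (`drop-∷`);
  -- so greedy removal needs no backtracking. The vertex and arc conditions on all tables are
  -- certified by evaluating this test.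
  _↭?_ : (xs ys : List X) → Dec (xs ↭ ys)
  [] ↭? [] = yes ↭-refl
  [] ↭? (y ∷ ys) = no λ p → ¬x∷xs↭[] (↭-sym p)
  (v ∷ xs) ↭? ys with extract v ys
  ... | no v∉ys = no λ p → v∉ys (xs , p)
  ... | yes (zs , p) = map′ (λ q → ↭-trans (prep v q) p) (λ q → drop-∷ (↭-trans q (↭-sym p))) (xs ↭? zs)

-- Vertices, arcs and closed walks

Vertex Arc : Set
Vertex = Bool × ℕ
Arc = Vertex × Vertex

_≟ᵛ_ : DecidableEquality Vertex
_≟ᵛ_ = ≡-dec Bool._≟_ ℕ._≟_

_≟ᵃ_ : DecidableEquality Arc
_≟ᵃ_ = ≡-dec _≟ᵛ_ _≟ᵛ_

x y : ℕ → Vertex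
x i = false , i
y i = true , i

shiftᵛ : ℕ → Vertex → Vertex
shiftᵛ k (a , i) = a , k + i

shiftᵃ : ℕ → Arc → Arc
shiftᵃ k (u , v) = shiftᵛ k u , shiftᵛ k v

walk : Vertex → List Vertex → Vertex → List Arc
walk u [] w = (u , w) ∷ []
walk u (v ∷ vs) w = (u , v) ∷ walk v vs w

arcs : List Vertex → List Arc
arcs [] = []
arcs (v ∷ vs) = walk v vs v

-- Sums over the nine factors, up to permutation

⨁ : {X : Set} → (Fin 9 → List X) → List X
⨁ f = concatMap f (allFin 9)

swap-tail : ∀ (as bs cs : List X) → (as ++ bs) ++ cs ↭ (as ++ cs) ++ bs
swap-tail as bs cs = begin
  (as ++ bs) ++ cs ≡⟨ ++-assoc as bs cs ⟩
  as ++ bs ++ cs   ↭⟨ ++⁺ˡ as (++-comm bs cs) ⟩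
  as ++ cs ++ bs   ≡⟨ ++-assoc as cs bs ⟨
  (as ++ cs) ++ bs ∎
  where open PermutationReasoning

concatMap-zip : ∀ (f g : I → List X) is →
  concatMap (λ i → f i ++ g i) is ↭ concatMap f is ++ concatMap g is
concatMap-zip f g [] = ↭-refl
concatMap-zip f g (i ∷ is) = begin
  (f i ++ g i) ++ concatMap (λ i → f i ++ g i) is     ↭⟨ ++⁺ˡ (f i ++ g i) (concatMap-zip f g is) ⟩
  (f i ++ g i) ++ concatMap f is ++ concatMap g is    ≡⟨ ++-assoc (f i) (g i) _ ⟩
  f i ++ g i ++ concatMap f is ++ concatMap g is      ↭⟨ ++⁺ˡ (f i) (shifts (g i) (concatMap f is)) ⟩
  f i ++ concatMap f is ++ g i ++ concatMap g is      ≡⟨ ++-assoc (f i) _ _ ⟨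
  (f i ++ concatMap f is) ++ g i ++ concatMap g is    ∎
  where open PermutationReasoning

concatMap-↭ : ∀ (f : I → List X) {is js} → is ↭ js → concatMap f is ↭ concatMap f js
concatMap-↭ f _↭_.refl = ↭-refl
concatMap-↭ f (prep i p) = ++⁺ˡ (f i) (concatMap-↭ f p)
concatMap-↭ f (swap i j p) =
  ↭-trans (shifts (f i) (f j)) (++⁺ˡ (f j) (++⁺ˡ (f i) (concatMap-↭ f p)))
concatMap-↭ f (_↭_.trans p q) = ↭-trans (concatMap-↭ f p) (concatMap-↭ f q)

concatMap-cong-↭ : ∀ {f g : I → List X} → (∀ i → f i ↭ g i) → ∀ is → concatMap f is ↭ concatMap g is
concatMap-cong-↭ p [] = ↭-refl
concatMap-cong-↭ p (i ∷ is) = ++⁺ (p i) (concatMap-cong-↭ p is)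

⨁-++ : ∀ (f g : Fin 9 → List X) → (⨁ λ j → f j ++ g j) ↭ ⨁ f ++ ⨁ g
⨁-++ f g = concatMap-zip f g (allFin 9)

⨁-cong : ∀ {f g : Fin 9 → List X} → (∀ j → f j ≡ g j) → ⨁ f ≡ ⨁ g
⨁-cong f≗g = concatMap-cong f≗g (allFin 9)

map-⨁ : ∀ (h : X → X) (f : Fin 9 → List X) → map h (⨁ f) ≡ ⨁ λ j → map h (f j)
map-⨁ h f = map-concatMap h f (allFin 9)

-- Tilings of a strip, for vertices and for arcs

module Tiling (shift : ℕ → X → X)
              (shift-0 : ∀ v → shift 0 v ≡ v)
              (shift-+ : ∀ m n v → shift (m + n) v ≡ shift m (shift n v))
              (unit : List X) where

  strip : ℕ → List X
  strip zero = []
  strip (suc n) = unit ++ map (shift 1) (strip n)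

  -- The elements xs occupy m units, except that those in `before` were already provided by the units
  -- on the left and that those in `after` stick out on the right.
  record Tiles (m : ℕ) (xs before after : List X) : Set where
    constructor tiles
    field
      fits : xs ++ before ↭ strip m ++ map (shift m) after

  strip-+ : ∀ m n → strip (m + n) ≡ strip m ++ map (shift m) (strip n)
  strip-+ zero n = trans (sym (map-id _)) (map-cong (λ v → sym (shift-0 v)) (strip n))
  strip-+ (suc m) n = begin
    unit ++ map (shift 1) (strip (m + n))
      ≡⟨ cong (λ vs → unit ++ map (shift 1) vs) (strip-+ m n) ⟩
    unit ++ map (shift 1) (strip m ++ map (shift m) (strip n))
      ≡⟨ cong (unit ++_) (map-++ (shift 1) (strip m) _) ⟩
    unit ++ map (shift 1) (strip m) ++ map (shift 1) (map (shift m) (strip n))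
      ≡⟨ cong (λ vs → unit ++ map (shift 1) (strip m) ++ vs) (map-∘ (strip n)) ⟨
    unit ++ map (shift 1) (strip m) ++ map (λ v → shift 1 (shift m v)) (strip n)
      ≡⟨ cong (λ vs → unit ++ map (shift 1) (strip m) ++ vs) (map-cong (λ v → sym (shift-+ 1 m v)) (strip n)) ⟩
    unit ++ map (shift 1) (strip m) ++ map (shift (suc m)) (strip n)
      ≡⟨ ++-assoc unit _ _ ⟨
    (unit ++ map (shift 1) (strip m)) ++ map (shift (suc m)) (strip n) ∎
    where open ≡-Reasoning

  -- What sticks out of the left tile, translated by `m`, is just what the right tile takes as
  -- already provided, so `bs` cancels.
  tiles-++ : ∀ {m n xs ys as bs cs} →
    Tiles m xs as bs → Tiles n ys bs cs → Tiles (m + n) (xs ++ map (shift m) ys) as cs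
  tiles-++ {m} {n} {xs} {ys} {as} {bs} {cs} (tiles p) (tiles q) = tiles (begin
    (xs ++ map (shift m) ys) ++ as
      ↭⟨ swap-tail xs _ as ⟩
    (xs ++ as) ++ map (shift m) ys
      ↭⟨ ++⁺ʳ _ p ⟩
    (strip m ++ map (shift m) bs) ++ map (shift m) ys
      ≡⟨ ++-assoc (strip m) _ _ ⟩
    strip m ++ map (shift m) bs ++ map (shift m) ys
      ↭⟨ ++⁺ˡ (strip m) (++-comm (map (shift m) bs) _) ⟩
    strip m ++ map (shift m) ys ++ map (shift m) bs
      ≡⟨ cong (strip m ++_) (map-++ (shift m) ys bs) ⟨
    strip m ++ map (shift m) (ys ++ bs)
      ↭⟨ ++⁺ˡ (strip m) (↭-map⁺ (shift m) q) ⟩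
    strip m ++ map (shift m) (strip n ++ map (shift n) cs)
      ≡⟨ cong (strip m ++_) (map-++ (shift m) (strip n) _) ⟩
    strip m ++ map (shift m) (strip n) ++ map (shift m) (map (shift n) cs)
      ≡⟨ ++-assoc (strip m) _ _ ⟨
    (strip m ++ map (shift m) (strip n)) ++ map (shift m) (map (shift n) cs)
      ≡⟨ cong₂ _++_ (sym (strip-+ m n)) (trans (sym (map-∘ cs)) (map-cong (λ v → sym (shift-+ m n v)) cs)) ⟩
    strip (m + n) ++ map (shift (m + n)) cs ∎)
    where open PermutationReasoning

  tiles? : DecidableEquality X → ∀ m xs as bs → Dec (Tiles m xs as bs)
  tiles? _≟_ m xs as bs = map′ tiles Tiles.fits (_↭?_ _≟_ (xs ++ as) (strip m ++ map (shift m) bs))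

  tiles-resp-↭ : ∀ {m xs ys as bs} → xs ↭ ys → Tiles m xs as bs → Tiles m ys as bs
  tiles-resp-↭ {as = as} xs↭ys (tiles p) = tiles (↭-trans (++⁺ʳ as (↭-sym xs↭ys)) p)

-- The graph as a chain of units

shiftᵛ-+ : ∀ m n v → shiftᵛ (m + n) v ≡ shiftᵛ m (shiftᵛ n v)
shiftᵛ-+ m n (a , i) = cong (a ,_) (ℕ.+-assoc m n i)

-- J has the edges x_i y_i for columns 1 to m, but its other edges start from columns 0 to m-1.
-- Hence the vertical edge of the unit sits in column 1 and the other eight leave column 0.
edges : List Arc
edges = (x 1 , y 1) ∷ (x 0 , x 1) ∷ (y 0 , y 1) ∷ (x 0 , y 1) ∷ (y 0 , x 1)
      ∷ (x 0 , x 2) ∷ (y 0 , y 2) ∷ (x 0 , y 2) ∷ (y 0 , x 2) ∷ []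

-- The unit is column 0, so `𝕍.strip m` stops at column m-1. Columns m and m+1 enter a tiling only
-- as translates of omitted vertices.
module 𝕍 = Tiling shiftᵛ (λ _ → refl) shiftᵛ-+ (x 0 ∷ y 0 ∷ [])
flip : Arc → Arc
flip (u , v) = v , u

unitArcs : List Arc
unitArcs = edges ++ map flip edges

module 𝔸 = Tiling shiftᵃ (λ _ → refl) (λ m n (u , v) → cong₂ _,_ (shiftᵛ-+ m n u) (shiftᵛ-+ m n v)) unitArcs

-- Cutting and translating walks

walk-++ : ∀ u vs v ws w → walk u (vs ++ v ∷ ws) w ≡ walk u vs v ++ walk v ws w
walk-++ u [] v ws w = refl
walk-++ u (u′ ∷ vs) v ws w = cong ((u , u′) ∷_) (walk-++ u′ vs v ws w)

walk-shift : ∀ k u vs w →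
  walk (shiftᵛ k u) (map (shiftᵛ k) vs) (shiftᵛ k w) ≡ map (shiftᵃ k) (walk u vs w)
walk-shift k u [] w = refl
walk-shift k u (v ∷ vs) w = cong (_ ∷_) (walk-shift k v vs w)

arcs-shift : ∀ k vs → arcs (map (shiftᵛ k) vs) ≡ map (shiftᵃ k) (arcs vs)
arcs-shift k [] = refl
arcs-shift k (v ∷ vs) = walk-shift k v vs v

detour : Vertex → List Vertex → Vertex → List Vertex
detour u vs w = u ∷ vs ++ [ w ]

shift-detour : ∀ k u vs w →
  map (shiftᵛ k) (detour u vs w) ≡ detour (shiftᵛ k u) (map (shiftᵛ k) vs) (shiftᵛ k w)
shift-detour k u vs w = cong (shiftᵛ k u ∷_) (map-++ (shiftᵛ k) vs [ w ])

walk-detour : ∀ u us f vs g ws w →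
  walk u (us ++ detour f vs g ++ ws) w ≡ walk u us f ++ walk f vs g ++ walk g ws w
walk-detour u us f vs g ws w = begin
  walk u (us ++ f ∷ (vs ++ [ g ]) ++ ws) w   ≡⟨ walk-++ u us f _ w ⟩
  walk u us f ++ walk f ((vs ++ [ g ]) ++ ws) w
    ≡⟨ cong (λ vs′ → walk u us f ++ walk f vs′ w) (++-assoc vs [ g ] ws) ⟩
  walk u us f ++ walk f (vs ++ g ∷ ws) w     ≡⟨ cong (walk u us f ++_) (walk-++ f vs g ws w) ⟩
  walk u us f ++ walk f vs g ++ walk g ws w  ∎
  where open ≡-Reasoning

-- Pieces and their gluing

-- The vertices of {x₀, x₁, y₀, y₁} that are not in the j-th factor.
omittedTable : Vec (List Vertex) 9
omittedTable =
    ( (x 0 ∷ y 0 ∷ [])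
    ∷ (x 0 ∷ [])
    ∷ []
    ∷ (y 0 ∷ [])
    ∷ (x 0 ∷ y 1 ∷ [])
    ∷ (x 0 ∷ x 1 ∷ y 0 ∷ [])
    ∷ []
    ∷ (x 0 ∷ y 0 ∷ y 1 ∷ [])
    ∷ (x 1 ∷ y 0 ∷ [])
    ∷ [])

omitted : Fin 9 → List Vertex
omitted = lookup omittedTable

-- The one equation `vertices` makes the cycles of a factor disjoint and the factor admissible:
-- column 0 or 1 loses exactly those vertices whose translates are gained in columns m and m+1.
-- Lengths are fixed only up to order, so the cycles of different factors may be listed differently.
record Pieces (m : ℕ) (ks : List ℕ) : Set where
  field
    cycles    : Fin 9 → List (List Vertex)
    lengths   : ∀ j → map length (cycles j) ↭ map (2 *_) ks
    vertices  : ∀ j → 𝕍.Tiles m (concat (cycles j)) (omitted j) (omitted j)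
    partition : 𝔸.Tiles m (⨁ λ j → concatMap arcs (cycles j)) [] []

Realisable : List ℕ → Set
Realisable ks = Pieces (sum ks) ks

-- On zero columns both sides reduce to `omitted j`. This is the empty rest behind the first group
-- when lengths are grouped.
realisable-[] : Realisable []
realisable-[] = record
  { cycles    = λ _ → []
  ; lengths   = λ _ → ↭-refl
  ; vertices  = λ j → 𝕍.tiles (↭-reflexive (sym (map-id (omitted j))))
  ; partition = 𝔸.tiles ↭-refl
  }

realisable-↭ : ∀ {ks ls} → ks ↭ ls → Realisable ks → Realisable ls
realisable-↭ {ks} {ls} ks↭ls P =
  subst (λ m → Pieces m ls) (sum-↭ ks↭ls)
    (record { Pieces P ; lengths = λ j → ↭-trans (Pieces.lengths P j) (↭-map⁺ (2 *_) ks↭ls) })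

infixr 5 _⊕_
-- At the seam, factor `j` of the left piece contains the translates of `omitted j`, which are the
-- vertices that the translated factor `j` of the right piece lacks. No cycle is changed.
_⊕_ : ∀ {ks ls} → Realisable ks → Realisable ls → Realisable (ks ++ ls)
_⊕_ {ks} {ls} P Q = subst (λ k → Pieces k (ks ++ ls)) (sym (sum-++ ks ls)) record
  { cycles    = λ j → P.cycles j ++ map (map (shiftᵛ m)) (Q.cycles j)
  ; lengths   = λ j → begin
      map length (P.cycles j ++ map (map (shiftᵛ m)) (Q.cycles j))
        ≡⟨ map-++ length (P.cycles j) _ ⟩
      map length (P.cycles j) ++ map length (map (map (shiftᵛ m)) (Q.cycles j))
        ≡⟨ cong (map length (P.cycles j) ++_)
             (trans (sym (map-∘ (Q.cycles j))) (map-cong (length-map (shiftᵛ m)) (Q.cycles j))) ⟩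
      map length (P.cycles j) ++ map length (Q.cycles j)
        ↭⟨ ++⁺ (P.lengths j) (Q.lengths j) ⟩
      map (2 *_) ks ++ map (2 *_) ls
        ≡⟨ map-++ (2 *_) ks ls ⟨
      map (2 *_) (ks ++ ls) ∎
  ; vertices  = λ j → 𝕍.tiles-resp-↭
      (↭-reflexive (trans (cong (concat (P.cycles j) ++_) (sym (concat-map (Q.cycles j))))
                          (concat-++ (P.cycles j) _)))
      (𝕍.tiles-++ (P.vertices j) (Q.vertices j))
  ; partition = 𝔸.tiles-resp-↭ (↭-sym all-arcs) (𝔸.tiles-++ P.partition Q.partition)
  }
  where
  open PermutationReasoning
  module P = Pieces P
  module Q = Pieces Q
  m = sum ks
  arcs-of-shift : ∀ cs → concatMap arcs (map (map (shiftᵛ m)) cs) ≡ map (shiftᵃ m) (concatMap arcs cs)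
  arcs-of-shift cs = trans (concatMap-map arcs (map (shiftᵛ m)) cs)
    (trans (concatMap-cong (arcs-shift m) cs) (sym (map-concatMap (shiftᵃ m) arcs cs)))
  Parcs Qarcs : Fin 9 → List Arc
  Parcs j = concatMap arcs (P.cycles j)
  Qarcs j = concatMap arcs (Q.cycles j)
  all-arcs : (⨁ λ j → concatMap arcs (P.cycles j ++ map (map (shiftᵛ m)) (Q.cycles j)))
           ↭ ⨁ Parcs ++ map (shiftᵃ m) (⨁ Qarcs)
  all-arcs = begin
    (⨁ λ j → concatMap arcs (P.cycles j ++ map (map (shiftᵛ m)) (Q.cycles j)))
      ≡⟨ ⨁-cong (λ j → trans (concatMap-++ arcs (P.cycles j) (map (map (shiftᵛ m)) (Q.cycles j)))
                             (cong (Parcs j ++_) (arcs-of-shift (Q.cycles j)))) ⟩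
    (⨁ λ j → Parcs j ++ map (shiftᵃ m) (Qarcs j))
      ↭⟨ ⨁-++ Parcs (λ j → map (shiftᵃ m) (Qarcs j)) ⟩
    ⨁ Parcs ++ (⨁ λ j → map (shiftᵃ m) (Qarcs j))
      ≡⟨ cong (⨁ Parcs ++_) (map-⨁ (shiftᵃ m) Qarcs) ⟨
    ⨁ Parcs ++ map (shiftᵃ m) (⨁ Qarcs) ∎

pieces : ∀ ks (table : Vec (List (List Vertex)) 9) →
  let cs = lookup table; m = sum ks in
  {True (all? λ j → _↭?_ ℕ._≟_ (map length (cs j)) (map (2 *_) ks))} →
  {True (all? λ j → 𝕍.tiles? _≟ᵛ_ m (concat (cs j)) (omitted j) (omitted j))} →
  {True (𝔸.tiles? _≟ᵃ_ m (⨁ λ j → concatMap arcs (cs j)) [] [])} →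
  Realisable ks
pieces ks table {ls} {vs} {as} = record
  { cycles    = lookup table
  ; lengths   = toWitness ls
  ; vertices  = toWitness vs
  ; partition = toWitness as
  }

-- Pumping.  The long cycle of factor j consists of a path within the left end (`home`, if that end has
-- no further cycles) and a path within the right end that begins with `head` and ends with `last`.
-- Lengthening moves the latter two columns to the right; `outward` leads from `head` to its translate,
-- and `inward` leads from the translate of `last` back to `last`.
headTable : Vec Vertex 9
headTable =
    (y 2 ∷ x 3 ∷ x 3 ∷ y 3 ∷ y 3 ∷ y 2 ∷ y 2 ∷ x 2 ∷ y 4 ∷ [])

lastTable : Vec Vertex 9
lastTable =
    (x 2 ∷ y 2 ∷ y 2 ∷ y 2 ∷ x 2 ∷ y 3 ∷ x 3 ∷ y 3 ∷ x 3 ∷ [])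

outwardTable inwardTable : Vec (List Vertex) 9
outwardTable =
    ( (x 3 ∷ y 3 ∷ [])
    ∷ (x 2 ∷ y 3 ∷ [])
    ∷ []
    ∷ []
    ∷ (x 3 ∷ [])
    ∷ (x 4 ∷ x 3 ∷ [])
    ∷ []
    ∷ []
    ∷ (y 3 ∷ x 4 ∷ [])
    ∷ [])
inwardTable =
    ( []
    ∷ []
    ∷ (x 4 ∷ y 3 ∷ [])
    ∷ (x 3 ∷ x 4 ∷ [])
    ∷ (y 4 ∷ [])
    ∷ []
    ∷ (y 3 ∷ x 2 ∷ [])
    ∷ (x 3 ∷ y 2 ∷ [])
    ∷ []
    ∷ [])

homeTable : Vec (List Vertex) 9
homeTable =
    ( (y 1 ∷ x 1 ∷ [])
    ∷ (y 1 ∷ y 0 ∷ x 1 ∷ [])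
    ∷ (y 0 ∷ x 2 ∷ x 1 ∷ x 0 ∷ y 1 ∷ [])
    ∷ (x 2 ∷ x 0 ∷ x 1 ∷ y 1 ∷ [])
    ∷ (y 0 ∷ y 2 ∷ x 1 ∷ [])
    ∷ (y 1 ∷ x 2 ∷ [])
    ∷ (x 1 ∷ y 0 ∷ y 1 ∷ x 0 ∷ [])
    ∷ (x 1 ∷ [])
    ∷ (y 1 ∷ y 2 ∷ x 0 ∷ x 2 ∷ [])
    ∷ [])

head last : Fin 9 → Vertex
head = lookup headTable
last = lookup lastTable

outward inward home : Fin 9 → List Vertex
outward = lookup outwardTable
inward = lookup inwardTable
home = lookup homeTable

-- The interface between the two ends, the same for all ends: the vertices and arcs of the smallest left end.
frontier : Fin 9 → List Vertex
frontier j = home j ++ omitted j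

homeArcs : List Arc
homeArcs = ⨁ λ j → walk (last j) (home j) (head j)

-- Seen from the right, a left end looks like `home` translated by `sum ks`: each path has the same
-- endpoints and length, each factor occupies or omits the same vertices, and the arcs agree in
-- total, though not factor by factor. Hence every left end fits every right end.
record LeftEnd (ks : List ℕ) : Set where
  field
    path      : Fin 9 → List Vertex
    closed    : Fin 9 → List (List Vertex)
    length-path : ∀ j → length (path j) ≡ length (home j)
    lengths   : ∀ j → map length (closed j) ↭ map (2 *_) ks
    vertices  : ∀ j → 𝕍.Tiles (sum ks) (path j ++ concat (closed j)) (omitted j) (frontier j)
    partition : 𝔸.Tiles (sum ks)
      (⨁ λ j → walk (shiftᵛ (sum ks) (last j)) (path j) (shiftᵛ (sum ks) (head j)) ++ concatMap arcs (closed j))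
      [] homeArcs

leftEnd : ∀ ks (table : Vec (List Vertex × List (List Vertex)) 9) →
  let path = λ j → proj₁ (lookup table j); closed = λ j → proj₂ (lookup table j); m = sum ks in
  {True (all? λ j → length (path j) ℕ.≟ length (home j))} →
  {True (all? λ j → _↭?_ ℕ._≟_ (map length (closed j)) (map (2 *_) ks))} →
  {True (all? λ j → 𝕍.tiles? _≟ᵛ_ m (path j ++ concat (closed j)) (omitted j) (frontier j))} →
  {True (𝔸.tiles? _≟ᵃ_ m
    (⨁ λ j → walk (shiftᵛ m (last j)) (path j) (shiftᵛ m (head j)) ++ concatMap arcs (closed j))
    [] homeArcs)} →
  LeftEnd ks
leftEnd ks table {l} {ls} {vs} {as} = record
  { path        = λ j → proj₁ (lookup table j)
  ; closed      = λ j → proj₂ (lookup table j)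
  ; length-path = toWitness l
  ; lengths     = toWitness ls
  ; vertices    = toWitness vs
  ; partition   = toWitness as
  }

-- The length count includes `home`; as all left paths have that length, the long cycle gets length
-- 2k whichever left end closes it.
record RightEnd (k : ℕ) : Set where
  field
    path      : Fin 9 → List Vertex
    lengths   : ∀ j → length (detour (head j) (path j) (last j)) + length (home j) ≡ 2 * k
    vertices  : ∀ j → 𝕍.Tiles k (detour (head j) (path j) (last j)) (frontier j) (omitted j)
    partition : 𝔸.Tiles k (⨁ λ j → walk (head j) (path j) (last j)) homeArcs []

rightEnd : ∀ k (table : Vec (List Vertex) 9) →
  let path = lookup table in
  {True (all? λ j → length (detour (head j) (path j) (last j)) + length (home j) ℕ.≟ 2 * k)} →
  {True (all? λ j → 𝕍.tiles? _≟ᵛ_ k (detour (head j) (path j) (last j)) (frontier j) (omitted j))} →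
  {True (𝔸.tiles? _≟ᵃ_ k (⨁ λ j → walk (head j) (path j) (last j)) homeArcs [])} →
  RightEnd k
rightEnd k table {ls} {vs} {as} = record
  { path = lookup table; lengths = toWitness ls; vertices = toWitness vs; partition = toWitness as }

-- Two new columns receive the interface `frontier`, `homeArcs` on their left and reproduce it on
-- their right, so the old right end continues from there unchanged. They add four vertices to each
-- factor and 36 arcs, two units, in all.
lengthen : ∀ {k} → RightEnd k → RightEnd (2 + k)
lengthen {k} R = record
  { path      = path′
  ; lengths   = longer
  ; vertices  = λ j → 𝕍.tiles-resp-↭ (↭-sym (split j)) (𝕍.tiles-++ (ring-vertices j) (R.vertices j))
  ; partition = 𝔸.tiles-resp-↭ (↭-sym arcs-split) (𝔸.tiles-++ ring-partition R.partition)
  }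
  where
  module R = RightEnd R
  old path′ ring : Fin 9 → List Vertex
  old j = detour (head j) (R.path j) (last j)
  path′ j = outward j ++ map (shiftᵛ 2) (old j) ++ inward j
  -- Only the vertices matter here: `outward` and `inward` are two separate strands, and `ring-arcs`
  -- lists the arcs actually used.
  ring j = detour (head j) (outward j ++ inward j) (last j)
  ring-arcs old-arcs : Fin 9 → List Arc
  ring-arcs j = walk (head j) (outward j) (shiftᵛ 2 (head j)) ++ walk (shiftᵛ 2 (last j)) (inward j) (last j)
  old-arcs j = walk (head j) (R.path j) (last j)

  length-ring : ∀ j → length (ring j) ≡ 4
  length-ring = from-yes (all? λ j → length (ring j) ℕ.≟ 4)

  ring-vertices : ∀ j → 𝕍.Tiles 2 (ring j) (frontier j) (frontier j)
  ring-vertices = from-yes (all? λ j → 𝕍.tiles? _≟ᵛ_ 2 (ring j) (frontier j) (frontier j))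

  ring-partition : 𝔸.Tiles 2 (⨁ ring-arcs) homeArcs homeArcs
  ring-partition = from-yes (𝔸.tiles? _≟ᵃ_ 2 (⨁ ring-arcs) homeArcs homeArcs)

  split : ∀ j → detour (head j) (path′ j) (last j) ↭ ring j ++ map (shiftᵛ 2) (old j)
  split j = prep (head j) (begin
    (os ++ ms ++ is) ++ [ last j ]   ↭⟨ ++⁺ʳ _ (++⁺ˡ os (++-comm ms is)) ⟩
    (os ++ is ++ ms) ++ [ last j ]   ≡⟨ cong (_++ [ last j ]) (++-assoc os is ms) ⟨
    ((os ++ is) ++ ms) ++ [ last j ] ↭⟨ swap-tail (os ++ is) ms _ ⟩
    ((os ++ is) ++ [ last j ]) ++ ms ∎)
    where
    open PermutationReasoning
    os = outward j
    is = inward j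
    ms = map (shiftᵛ 2) (old j)

  longer : ∀ j → length (detour (head j) (path′ j) (last j)) + length (home j) ≡ 2 * (2 + k)
  longer j = begin
    length (detour (head j) (path′ j) (last j)) + length (home j)
      ≡⟨ cong (_+ length (home j)) (trans (↭-length (split j)) (length-++ (ring j))) ⟩
    (length (ring j) + length (map (shiftᵛ 2) (old j))) + length (home j)
      ≡⟨ cong₂ (λ a b → (a + b) + length (home j)) (length-ring j) (length-map (shiftᵛ 2) (old j)) ⟩
    4 + (length (old j) + length (home j))
      ≡⟨ cong (4 +_) (R.lengths j) ⟩
    4 + 2 * k
      ≡⟨ ℕ.*-distribˡ-+ 2 2 k ⟨
    2 * (2 + k) ∎
    where open ≡-Reasoning

  arcs-split : (⨁ λ j → walk (head j) (path′ j) (last j)) ↭ ⨁ ring-arcs ++ map (shiftᵃ 2) (⨁ old-arcs)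
  arcs-split = begin
    (⨁ λ j → walk (head j) (path′ j) (last j))
      ↭⟨ concatMap-cong-↭ split-walk (allFin 9) ⟩
    (⨁ λ j → ring-arcs j ++ map (shiftᵃ 2) (old-arcs j))
      ↭⟨ ⨁-++ ring-arcs (λ j → map (shiftᵃ 2) (old-arcs j)) ⟩
    ⨁ ring-arcs ++ (⨁ λ j → map (shiftᵃ 2) (old-arcs j))
      ≡⟨ cong (⨁ ring-arcs ++_) (map-⨁ (shiftᵃ 2) old-arcs) ⟨
    ⨁ ring-arcs ++ map (shiftᵃ 2) (⨁ old-arcs) ∎
    where
    open PermutationReasoning
    split-walk : ∀ j → walk (head j) (path′ j) (last j) ↭ ring-arcs j ++ map (shiftᵃ 2) (old-arcs j)
    split-walk j = begin
      walk f (outward j ++ map (shiftᵛ 2) (old j) ++ inward j) g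
        ≡⟨ cong (λ vs → walk f (outward j ++ vs ++ inward j) g) (shift-detour 2 f (R.path j) g) ⟩
      walk f (outward j ++ detour f′ (map (shiftᵛ 2) (R.path j)) g′ ++ inward j) g
        ≡⟨ walk-detour f (outward j) f′ _ g′ (inward j) g ⟩
      walk f (outward j) f′ ++ walk f′ (map (shiftᵛ 2) (R.path j)) g′ ++ walk g′ (inward j) g
        ≡⟨ cong (λ as → walk f (outward j) f′ ++ as ++ walk g′ (inward j) g) (walk-shift 2 f (R.path j) g) ⟩
      walk f (outward j) f′ ++ map (shiftᵃ 2) (old-arcs j) ++ walk g′ (inward j) g
        ↭⟨ ++⁺ˡ (walk f (outward j) f′) (++-comm (map (shiftᵃ 2) (old-arcs j)) _) ⟩
      walk f (outward j) f′ ++ walk g′ (inward j) g ++ map (shiftᵃ 2) (old-arcs j)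
        ≡⟨ ++-assoc (walk f (outward j) f′) _ _ ⟨
      ring-arcs j ++ map (shiftᵃ 2) (old-arcs j) ∎
      where
      f = head j
      g = last j
      f′ = shiftᵛ 2 f
      g′ = shiftᵛ 2 g

-- The cycle follows the right path from `head` to `last` and returns along the left path, whose
-- final arc leads back to `head`.
close : ∀ {k ks} → LeftEnd ks → RightEnd k → Realisable (k ∷ ks)
-- The left end comes first in space, giving s + k columns, whereas k comes first in the list.
close {k} {ks} L R = subst (λ m → Pieces m (k ∷ ks)) (ℕ.+-comm s k) record
  { cycles    = λ j → cycle j ∷ L.closed j
  ; lengths   = λ j → begin
      length (cycle j) ∷ map length (L.closed j)
        ≡⟨ cong (_∷ map length (L.closed j)) (length-cycle j) ⟩
      2 * k ∷ map length (L.closed j)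
        ↭⟨ prep (2 * k) (L.lengths j) ⟩
      2 * k ∷ map (2 *_) ks ∎
  ; vertices  = λ j → 𝕍.tiles-resp-↭ (cycle-vertices j) (𝕍.tiles-++ (L.vertices j) (R.vertices j))
  ; partition = 𝔸.tiles-resp-↭ cycle-arcs (𝔸.tiles-++ L.partition R.partition)
  }
  where
  open PermutationReasoning
  module L = LeftEnd L
  module R = RightEnd R
  s = sum ks
  far cycle : Fin 9 → List Vertex
  far j = detour (head j) (R.path j) (last j)
  cycle j = map (shiftᵛ s) (far j) ++ L.path j

  length-cycle : ∀ j → length (cycle j) ≡ 2 * k
  length-cycle j = trans (length-++ (map (shiftᵛ s) (far j)))
    (trans (cong₂ _+_ (length-map (shiftᵛ s) (far j)) (L.length-path j)) (R.lengths j))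

  cycle-vertices : ∀ j → (L.path j ++ concat (L.closed j)) ++ map (shiftᵛ s) (far j)
                       ↭ cycle j ++ concat (L.closed j)
  cycle-vertices j = begin
    (L.path j ++ concat (L.closed j)) ++ map (shiftᵛ s) (far j)
      ↭⟨ ++-comm _ (map (shiftᵛ s) (far j)) ⟩
    map (shiftᵛ s) (far j) ++ L.path j ++ concat (L.closed j)
      ≡⟨ ++-assoc (map (shiftᵛ s) (far j)) _ _ ⟨
    cycle j ++ concat (L.closed j) ∎

  near-arcs far-arcs : Fin 9 → List Arc
  near-arcs j = walk (shiftᵛ s (last j)) (L.path j) (shiftᵛ s (head j)) ++ concatMap arcs (L.closed j)
  far-arcs j = walk (head j) (R.path j) (last j)

  cycle-arcs : ⨁ near-arcs ++ map (shiftᵃ s) (⨁ far-arcs)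
             ↭ ⨁ λ j → arcs (cycle j) ++ concatMap arcs (L.closed j)
  cycle-arcs = begin
    ⨁ near-arcs ++ map (shiftᵃ s) (⨁ far-arcs)
      ↭⟨ ++-comm (⨁ near-arcs) _ ⟩
    map (shiftᵃ s) (⨁ far-arcs) ++ ⨁ near-arcs
      ≡⟨ cong (_++ ⨁ near-arcs) (map-⨁ (shiftᵃ s) far-arcs) ⟩
    (⨁ λ j → map (shiftᵃ s) (far-arcs j)) ++ ⨁ near-arcs
      ↭⟨ ⨁-++ (λ j → map (shiftᵃ s) (far-arcs j)) near-arcs ⟨
    (⨁ λ j → map (shiftᵃ s) (far-arcs j) ++ near-arcs j)
      ≡⟨ ⨁-cong join ⟩
    (⨁ λ j → arcs (cycle j) ++ concatMap arcs (L.closed j)) ∎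
    where
    join : ∀ j → map (shiftᵃ s) (far-arcs j) ++ near-arcs j ≡ arcs (cycle j) ++ concatMap arcs (L.closed j)
    join j = E.begin
      map (shiftᵃ s) (far-arcs j) ++ walk g (L.path j) f ++ concatMap arcs (L.closed j)
        E.≡⟨ ++-assoc (map (shiftᵃ s) (far-arcs j)) (walk g (L.path j) f) _ ⟨
      (map (shiftᵃ s) (far-arcs j) ++ walk g (L.path j) f) ++ concatMap arcs (L.closed j)
        E.≡⟨ cong (λ as → (as ++ walk g (L.path j) f) ++ concatMap arcs (L.closed j))
              (walk-shift s (head j) (R.path j) (last j)) ⟨
      (walk f (map (shiftᵛ s) (R.path j)) g ++ walk g (L.path j) f) ++ concatMap arcs (L.closed j)
        E.≡⟨ cong (_++ concatMap arcs (L.closed j)) (walk-++ f (map (shiftᵛ s) (R.path j)) g (L.path j) f) ⟨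
      walk f (map (shiftᵛ s) (R.path j) ++ g ∷ L.path j) f ++ concatMap arcs (L.closed j)
        E.≡⟨ cong (λ vs → walk f vs f ++ concatMap arcs (L.closed j))
              (trans (sym (++-assoc (map (shiftᵛ s) (R.path j)) [ g ] (L.path j)))
                     (cong (_++ L.path j) (sym (map-++ (shiftᵛ s) (R.path j) [ last j ])))) ⟩
      arcs (cycle j) ++ concatMap arcs (L.closed j) E.∎
      where
      module E = ≡-Reasoning
      f = shiftᵛ s (head j)
      g = shiftᵛ s (last j)

-- Search results: the two ends

rightEnd4 : RightEnd 4
rightEnd4 = rightEnd 4
    ( (x 4 ∷ y 3 ∷ x 3 ∷ y 4 ∷ [])
    ∷ (x 2 ∷ y 3 ∷ x 4 ∷ [])
    ∷ (y 3 ∷ [])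
    ∷ (y 4 ∷ x 3 ∷ [])
    ∷ (y 5 ∷ x 3 ∷ x 4 ∷ [])
    ∷ (y 4 ∷ x 4 ∷ x 3 ∷ x 5 ∷ [])
    ∷ (y 3 ∷ x 2 ∷ [])
    ∷ (x 4 ∷ y 4 ∷ y 2 ∷ x 3 ∷ y 5 ∷ [])
    ∷ (y 3 ∷ x 5 ∷ [])
    ∷ [])

rightEnd5 : RightEnd 5
rightEnd5 = rightEnd 5
    ( (x 3 ∷ x 4 ∷ x 5 ∷ y 5 ∷ y 4 ∷ y 3 ∷ [])
    ∷ (x 5 ∷ y 4 ∷ x 4 ∷ x 2 ∷ y 3 ∷ [])
    ∷ (y 3 ∷ x 4 ∷ y 4 ∷ [])
    ∷ (x 3 ∷ y 4 ∷ y 5 ∷ x 4 ∷ [])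
    ∷ (x 5 ∷ x 4 ∷ y 6 ∷ y 4 ∷ x 3 ∷ [])
    ∷ (x 4 ∷ x 6 ∷ y 4 ∷ x 5 ∷ x 3 ∷ y 5 ∷ [])
    ∷ (y 3 ∷ y 4 ∷ x 2 ∷ x 4 ∷ [])
    ∷ (x 3 ∷ y 2 ∷ y 4 ∷ y 6 ∷ x 4 ∷ y 5 ∷ x 5 ∷ [])
    ∷ (x 6 ∷ x 4 ∷ y 3 ∷ y 5 ∷ [])
    ∷ [])

-- Lengthening raises k by 2, so one table is needed for each parity.
right : ∀ n → RightEnd (4 + n)
right 0 = rightEnd4
right 1 = rightEnd5
right (suc (suc n)) = lengthen (right n)

leftEnd-0 : LeftEnd []
leftEnd-0 = leftEnd [] (Vec.map (_, []) homeTable)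

leftEnd-1 : LeftEnd (1 ∷ [])
leftEnd-1 = leftEnd (1 ∷ [])
    ( ((y 2 ∷ x 1 ∷ []) , ((y 1 ∷ x 2 ∷ []) ∷ []))
    ∷ ((y 1 ∷ x 1 ∷ y 2 ∷ []) , ((y 0 ∷ x 2 ∷ []) ∷ []))
    ∷ ((y 2 ∷ x 0 ∷ x 1 ∷ x 3 ∷ x 2 ∷ []) , ((y 0 ∷ y 1 ∷ []) ∷ []))
    ∷ ((x 1 ∷ x 0 ∷ y 2 ∷ x 2 ∷ []) , ((y 1 ∷ x 3 ∷ []) ∷ []))
    ∷ ((x 1 ∷ y 0 ∷ y 2 ∷ []) , ((x 2 ∷ y 3 ∷ []) ∷ []))
    ∷ ((x 2 ∷ x 3 ∷ []) , ((y 1 ∷ y 2 ∷ []) ∷ []))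
    ∷ ((y 2 ∷ y 0 ∷ x 1 ∷ y 1 ∷ []) , ((x 0 ∷ x 2 ∷ []) ∷ []))
    ∷ ((y 2 ∷ []) , ((x 1 ∷ x 2 ∷ []) ∷ []))
    ∷ ((x 2 ∷ y 2 ∷ y 3 ∷ x 3 ∷ []) , ((x 0 ∷ y 1 ∷ []) ∷ []))
    ∷ [])

leftEnd-1-1 : LeftEnd (1 ∷ 1 ∷ [])
leftEnd-1-1 = leftEnd (1 ∷ 1 ∷ [])
    ( ((x 3 ∷ y 3 ∷ []) , ((x 1 ∷ y 1 ∷ []) ∷ (x 2 ∷ y 2 ∷ []) ∷ []))
    ∷ ((x 3 ∷ x 2 ∷ y 3 ∷ []) , ((y 0 ∷ y 1 ∷ []) ∷ (x 1 ∷ y 2 ∷ []) ∷ []))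
    ∷ ((x 2 ∷ x 4 ∷ y 3 ∷ y 1 ∷ x 3 ∷ []) , ((x 0 ∷ y 2 ∷ []) ∷ (y 0 ∷ x 1 ∷ []) ∷ []))
    ∷ ((y 2 ∷ x 4 ∷ x 2 ∷ x 3 ∷ []) , ((x 0 ∷ y 1 ∷ []) ∷ (x 1 ∷ y 3 ∷ []) ∷ []))
    ∷ ((y 2 ∷ y 4 ∷ y 3 ∷ []) , ((y 0 ∷ x 2 ∷ []) ∷ (x 1 ∷ x 3 ∷ []) ∷ []))
    ∷ ((x 3 ∷ x 4 ∷ []) , ((y 1 ∷ x 2 ∷ []) ∷ (y 2 ∷ y 3 ∷ []) ∷ []))
    ∷ ((x 3 ∷ y 1 ∷ y 3 ∷ x 2 ∷ []) , ((x 0 ∷ x 1 ∷ []) ∷ (y 0 ∷ y 2 ∷ []) ∷ []))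
    ∷ ((y 3 ∷ []) , ((x 1 ∷ x 2 ∷ []) ∷ (y 2 ∷ x 3 ∷ []) ∷ []))
    ∷ ((y 3 ∷ x 3 ∷ y 4 ∷ x 4 ∷ []) , ((x 0 ∷ x 2 ∷ []) ∷ (y 1 ∷ y 2 ∷ []) ∷ []))
    ∷ [])

leftEnd-2 : LeftEnd (2 ∷ [])
leftEnd-2 = leftEnd (2 ∷ [])
    ( ((x 3 ∷ x 2 ∷ []) , ((x 1 ∷ y 1 ∷ y 2 ∷ y 3 ∷ []) ∷ []))
    ∷ ((y 2 ∷ x 1 ∷ x 3 ∷ []) , ((y 0 ∷ y 1 ∷ y 3 ∷ x 2 ∷ []) ∷ []))
    ∷ ((x 2 ∷ y 1 ∷ x 3 ∷ x 4 ∷ y 3 ∷ []) , ((x 0 ∷ x 1 ∷ y 0 ∷ y 2 ∷ []) ∷ []))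
    ∷ ((x 3 ∷ y 1 ∷ x 1 ∷ y 3 ∷ []) , ((x 0 ∷ y 2 ∷ x 4 ∷ x 2 ∷ []) ∷ []))
    ∷ ((y 4 ∷ y 3 ∷ x 3 ∷ []) , ((y 0 ∷ x 2 ∷ x 1 ∷ y 2 ∷ []) ∷ []))
    ∷ ((x 3 ∷ y 3 ∷ []) , ((y 1 ∷ x 2 ∷ x 4 ∷ y 2 ∷ []) ∷ []))
    ∷ ((y 3 ∷ y 2 ∷ x 2 ∷ x 3 ∷ []) , ((x 0 ∷ y 1 ∷ y 0 ∷ x 1 ∷ []) ∷ []))
    ∷ ((y 3 ∷ []) , ((x 1 ∷ x 2 ∷ y 2 ∷ x 3 ∷ []) ∷ []))
    ∷ ((x 3 ∷ y 2 ∷ y 4 ∷ x 4 ∷ []) , ((x 0 ∷ x 2 ∷ y 3 ∷ y 1 ∷ []) ∷ []))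
    ∷ [])

-- Search results: complete pieces

pieces-3 : Realisable (3 ∷ [])
pieces-3 = pieces (3 ∷ [])
    ( ((x 1 ∷ y 3 ∷ x 3 ∷ y 2 ∷ y 1 ∷ x 2 ∷ []) ∷ [])
    ∷ ((y 0 ∷ x 1 ∷ x 2 ∷ y 2 ∷ x 3 ∷ y 1 ∷ []) ∷ [])
    ∷ ((x 0 ∷ y 2 ∷ x 2 ∷ y 0 ∷ y 1 ∷ x 1 ∷ []) ∷ [])
    ∷ ((x 0 ∷ x 2 ∷ y 3 ∷ x 1 ∷ y 1 ∷ y 2 ∷ []) ∷ [])
    ∷ ((y 0 ∷ y 2 ∷ y 4 ∷ x 2 ∷ x 3 ∷ x 1 ∷ []) ∷ [])
    ∷ ((y 1 ∷ x 3 ∷ x 2 ∷ x 4 ∷ y 2 ∷ y 3 ∷ []) ∷ [])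
    ∷ ((x 0 ∷ x 1 ∷ y 2 ∷ y 0 ∷ x 2 ∷ y 1 ∷ []) ∷ [])
    ∷ ((x 1 ∷ x 3 ∷ y 3 ∷ x 2 ∷ y 4 ∷ y 2 ∷ []) ∷ [])
    ∷ ((x 0 ∷ y 1 ∷ y 3 ∷ y 2 ∷ x 4 ∷ x 2 ∷ []) ∷ [])
    ∷ [])

pieces-2-1 : Realisable (2 ∷ 1 ∷ [])
pieces-2-1 = pieces (2 ∷ 1 ∷ [])
    ( ((x 1 ∷ x 2 ∷ y 3 ∷ y 2 ∷ []) ∷ (y 1 ∷ x 3 ∷ []) ∷ [])
    ∷ ((y 0 ∷ x 2 ∷ x 3 ∷ y 2 ∷ []) ∷ (x 1 ∷ y 1 ∷ []) ∷ [])
    ∷ ((x 0 ∷ x 1 ∷ y 0 ∷ y 2 ∷ []) ∷ (y 1 ∷ x 2 ∷ []) ∷ [])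
    ∷ ((x 0 ∷ x 2 ∷ y 2 ∷ y 1 ∷ []) ∷ (x 1 ∷ y 3 ∷ []) ∷ [])
    ∷ ((y 0 ∷ x 1 ∷ x 3 ∷ x 2 ∷ []) ∷ (y 2 ∷ y 4 ∷ []) ∷ [])
    ∷ ((y 1 ∷ y 2 ∷ x 3 ∷ y 3 ∷ []) ∷ (x 2 ∷ x 4 ∷ []) ∷ [])
    ∷ ((x 0 ∷ y 2 ∷ x 2 ∷ x 1 ∷ []) ∷ (y 0 ∷ y 1 ∷ []) ∷ [])
    ∷ ((x 1 ∷ y 2 ∷ y 3 ∷ x 3 ∷ []) ∷ (x 2 ∷ y 4 ∷ []) ∷ [])
    ∷ ((x 0 ∷ y 1 ∷ y 3 ∷ x 2 ∷ []) ∷ (y 2 ∷ x 4 ∷ []) ∷ [])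
    ∷ [])

pieces-1-1-1 : Realisable (1 ∷ 1 ∷ 1 ∷ [])
pieces-1-1-1 = pieces (1 ∷ 1 ∷ 1 ∷ [])
    ( ((x 1 ∷ x 3 ∷ []) ∷ (y 1 ∷ y 3 ∷ []) ∷ (x 2 ∷ y 2 ∷ []) ∷ [])
    ∷ ((y 0 ∷ x 2 ∷ []) ∷ (x 1 ∷ y 2 ∷ []) ∷ (y 1 ∷ x 3 ∷ []) ∷ [])
    ∷ ((x 0 ∷ y 2 ∷ []) ∷ (y 0 ∷ y 1 ∷ []) ∷ (x 1 ∷ x 2 ∷ []) ∷ [])
    ∷ ((x 0 ∷ x 2 ∷ []) ∷ (x 1 ∷ y 1 ∷ []) ∷ (y 2 ∷ y 3 ∷ []) ∷ [])
    ∷ ((y 0 ∷ x 1 ∷ []) ∷ (x 2 ∷ y 4 ∷ []) ∷ (y 2 ∷ x 3 ∷ []) ∷ [])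
    ∷ ((y 1 ∷ y 2 ∷ []) ∷ (x 2 ∷ x 4 ∷ []) ∷ (x 3 ∷ y 3 ∷ []) ∷ [])
    ∷ ((x 0 ∷ x 1 ∷ []) ∷ (y 0 ∷ y 2 ∷ []) ∷ (y 1 ∷ x 2 ∷ []) ∷ [])
    ∷ ((x 1 ∷ y 3 ∷ []) ∷ (x 2 ∷ x 3 ∷ []) ∷ (y 2 ∷ y 4 ∷ []) ∷ [])
    ∷ ((x 0 ∷ y 1 ∷ []) ∷ (x 2 ∷ y 3 ∷ []) ∷ (y 2 ∷ x 4 ∷ []) ∷ [])
    ∷ [])

pieces-3-1 : Realisable (3 ∷ 1 ∷ [])
pieces-3-1 = pieces (3 ∷ 1 ∷ [])
    ( ((x 1 ∷ y 1 ∷ x 2 ∷ x 4 ∷ y 4 ∷ x 3 ∷ []) ∷ (y 2 ∷ y 3 ∷ []) ∷ [])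
    ∷ ((y 0 ∷ y 1 ∷ []) ∷ (x 1 ∷ x 3 ∷ x 4 ∷ y 3 ∷ x 2 ∷ y 2 ∷ []) ∷ [])
    ∷ ((x 0 ∷ y 2 ∷ y 0 ∷ x 2 ∷ y 1 ∷ x 1 ∷ []) ∷ (x 3 ∷ y 3 ∷ []) ∷ [])
    ∷ ((x 0 ∷ x 1 ∷ x 2 ∷ x 3 ∷ y 2 ∷ y 1 ∷ []) ∷ (y 3 ∷ y 4 ∷ []) ∷ [])
    ∷ ((y 0 ∷ x 1 ∷ y 3 ∷ x 4 ∷ y 2 ∷ x 2 ∷ []) ∷ (x 3 ∷ y 5 ∷ []) ∷ [])
    ∷ ((y 1 ∷ y 2 ∷ x 4 ∷ x 3 ∷ x 5 ∷ y 3 ∷ []) ∷ (x 2 ∷ y 4 ∷ []) ∷ [])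
    ∷ ((x 0 ∷ x 2 ∷ y 3 ∷ x 1 ∷ y 0 ∷ y 2 ∷ []) ∷ (y 1 ∷ x 3 ∷ []) ∷ [])
    ∷ ((x 1 ∷ y 2 ∷ x 3 ∷ y 4 ∷ x 4 ∷ x 2 ∷ []) ∷ (y 3 ∷ y 5 ∷ []) ∷ [])
    ∷ ((x 0 ∷ y 1 ∷ y 3 ∷ x 5 ∷ x 3 ∷ x 2 ∷ []) ∷ (y 2 ∷ y 4 ∷ []) ∷ [])
    ∷ [])

pieces-2-2 : Realisable (2 ∷ 2 ∷ [])
pieces-2-2 = pieces (2 ∷ 2 ∷ [])
    ( ((x 1 ∷ x 2 ∷ x 3 ∷ y 1 ∷ []) ∷ (y 2 ∷ y 3 ∷ x 4 ∷ y 4 ∷ []) ∷ [])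
    ∷ ((y 0 ∷ y 2 ∷ x 1 ∷ y 1 ∷ []) ∷ (x 2 ∷ x 4 ∷ x 3 ∷ y 3 ∷ []) ∷ [])
    ∷ ((x 0 ∷ x 1 ∷ y 0 ∷ y 1 ∷ []) ∷ (x 2 ∷ y 3 ∷ y 2 ∷ x 3 ∷ []) ∷ [])
    ∷ ((x 0 ∷ y 2 ∷ y 4 ∷ x 2 ∷ []) ∷ (x 1 ∷ y 3 ∷ y 1 ∷ x 3 ∷ []) ∷ [])
    ∷ ((y 0 ∷ x 2 ∷ x 1 ∷ y 2 ∷ []) ∷ (x 3 ∷ x 4 ∷ y 3 ∷ y 5 ∷ []) ∷ [])
    ∷ ((y 1 ∷ y 2 ∷ x 4 ∷ x 2 ∷ []) ∷ (x 3 ∷ x 5 ∷ y 3 ∷ y 4 ∷ []) ∷ [])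
    ∷ ((x 0 ∷ x 2 ∷ y 0 ∷ x 1 ∷ []) ∷ (y 1 ∷ y 3 ∷ x 3 ∷ y 2 ∷ []) ∷ [])
    ∷ ((x 1 ∷ x 3 ∷ y 5 ∷ y 3 ∷ []) ∷ (x 2 ∷ y 4 ∷ x 4 ∷ y 2 ∷ []) ∷ [])
    ∷ ((x 0 ∷ y 1 ∷ x 2 ∷ y 2 ∷ []) ∷ (x 3 ∷ y 4 ∷ y 3 ∷ x 5 ∷ []) ∷ [])
    ∷ [])

pieces-2-1-1 : Realisable (2 ∷ 1 ∷ 1 ∷ [])
pieces-2-1-1 = pieces (2 ∷ 1 ∷ 1 ∷ [])
    ( ((x 1 ∷ x 3 ∷ y 1 ∷ x 2 ∷ []) ∷ (y 2 ∷ y 4 ∷ []) ∷ (y 3 ∷ x 4 ∷ []) ∷ [])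
    ∷ ((y 0 ∷ x 2 ∷ []) ∷ (x 1 ∷ y 3 ∷ y 2 ∷ y 1 ∷ []) ∷ (x 3 ∷ x 4 ∷ []) ∷ [])
    ∷ ((x 0 ∷ x 1 ∷ y 2 ∷ x 2 ∷ []) ∷ (y 0 ∷ y 1 ∷ []) ∷ (x 3 ∷ y 3 ∷ []) ∷ [])
    ∷ ((x 0 ∷ y 2 ∷ x 1 ∷ y 1 ∷ []) ∷ (x 2 ∷ y 3 ∷ []) ∷ (x 3 ∷ y 4 ∷ []) ∷ [])
    ∷ ((y 0 ∷ x 1 ∷ []) ∷ (x 2 ∷ x 4 ∷ y 2 ∷ x 3 ∷ []) ∷ (y 3 ∷ y 5 ∷ []) ∷ [])
    ∷ ((y 1 ∷ y 2 ∷ x 4 ∷ x 2 ∷ []) ∷ (x 3 ∷ x 5 ∷ []) ∷ (y 3 ∷ y 4 ∷ []) ∷ [])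
    ∷ ((x 0 ∷ x 2 ∷ x 3 ∷ x 1 ∷ []) ∷ (y 0 ∷ y 2 ∷ []) ∷ (y 1 ∷ y 3 ∷ []) ∷ [])
    ∷ ((x 1 ∷ x 2 ∷ y 2 ∷ y 3 ∷ []) ∷ (x 3 ∷ y 5 ∷ []) ∷ (x 4 ∷ y 4 ∷ []) ∷ [])
    ∷ ((x 0 ∷ y 1 ∷ x 3 ∷ y 2 ∷ []) ∷ (x 2 ∷ y 4 ∷ []) ∷ (y 3 ∷ x 5 ∷ []) ∷ [])
    ∷ [])

pieces-1-1-1-1 : Realisable (1 ∷ 1 ∷ 1 ∷ 1 ∷ [])
pieces-1-1-1-1 = pieces (1 ∷ 1 ∷ 1 ∷ 1 ∷ [])
    ( ((x 1 ∷ x 2 ∷ []) ∷ (y 1 ∷ y 3 ∷ []) ∷ (y 2 ∷ x 3 ∷ []) ∷ (x 4 ∷ y 4 ∷ []) ∷ [])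
    ∷ ((y 0 ∷ x 2 ∷ []) ∷ (x 1 ∷ y 1 ∷ []) ∷ (y 2 ∷ y 3 ∷ []) ∷ (x 3 ∷ x 4 ∷ []) ∷ [])
    ∷ ((x 0 ∷ y 2 ∷ []) ∷ (y 0 ∷ y 1 ∷ []) ∷ (x 1 ∷ x 3 ∷ []) ∷ (x 2 ∷ y 3 ∷ []) ∷ [])
    ∷ ((x 0 ∷ x 1 ∷ []) ∷ (y 1 ∷ x 2 ∷ []) ∷ (y 2 ∷ y 4 ∷ []) ∷ (x 3 ∷ y 3 ∷ []) ∷ [])
    ∷ ((y 0 ∷ x 1 ∷ []) ∷ (x 2 ∷ x 3 ∷ []) ∷ (y 2 ∷ x 4 ∷ []) ∷ (y 3 ∷ y 5 ∷ []) ∷ [])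
    ∷ ((y 1 ∷ y 2 ∷ []) ∷ (x 2 ∷ x 4 ∷ []) ∷ (x 3 ∷ x 5 ∷ []) ∷ (y 3 ∷ y 4 ∷ []) ∷ [])
    ∷ ((x 0 ∷ x 2 ∷ []) ∷ (y 0 ∷ y 2 ∷ []) ∷ (x 1 ∷ y 3 ∷ []) ∷ (y 1 ∷ x 3 ∷ []) ∷ [])
    ∷ ((x 1 ∷ y 2 ∷ []) ∷ (x 2 ∷ y 4 ∷ []) ∷ (x 3 ∷ y 5 ∷ []) ∷ (y 3 ∷ x 4 ∷ []) ∷ [])
    ∷ ((x 0 ∷ y 1 ∷ []) ∷ (x 2 ∷ y 2 ∷ []) ∷ (x 3 ∷ y 4 ∷ []) ∷ (y 3 ∷ x 5 ∷ []) ∷ [])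
    ∷ [])

pieces-1-1-1-1-1 : Realisable (1 ∷ 1 ∷ 1 ∷ 1 ∷ 1 ∷ [])
pieces-1-1-1-1-1 = pieces (1 ∷ 1 ∷ 1 ∷ 1 ∷ 1 ∷ [])
    ( ((x 1 ∷ x 2 ∷ []) ∷ (y 1 ∷ y 3 ∷ []) ∷ (y 2 ∷ y 4 ∷ []) ∷ (x 3 ∷ x 5 ∷ []) ∷ (x 4 ∷ y 5 ∷ []) ∷ [])
    ∷ ((y 0 ∷ y 2 ∷ []) ∷ (x 1 ∷ y 3 ∷ []) ∷ (y 1 ∷ x 2 ∷ []) ∷ (x 3 ∷ y 4 ∷ []) ∷ (x 4 ∷ x 5 ∷ []) ∷ [])
    ∷ ((x 0 ∷ x 2 ∷ []) ∷ (y 0 ∷ y 1 ∷ []) ∷ (x 1 ∷ x 3 ∷ []) ∷ (y 2 ∷ y 3 ∷ []) ∷ (x 4 ∷ y 4 ∷ []) ∷ [])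
    ∷ ((x 0 ∷ x 1 ∷ []) ∷ (y 1 ∷ x 3 ∷ []) ∷ (x 2 ∷ y 3 ∷ []) ∷ (y 2 ∷ x 4 ∷ []) ∷ (y 4 ∷ y 5 ∷ []) ∷ [])
    ∷ ((y 0 ∷ x 1 ∷ []) ∷ (x 2 ∷ x 4 ∷ []) ∷ (y 2 ∷ x 3 ∷ []) ∷ (y 3 ∷ x 5 ∷ []) ∷ (y 4 ∷ y 6 ∷ []) ∷ [])
    ∷ ((y 1 ∷ y 2 ∷ []) ∷ (x 2 ∷ x 3 ∷ []) ∷ (y 3 ∷ y 5 ∷ []) ∷ (x 4 ∷ x 6 ∷ []) ∷ (y 4 ∷ x 5 ∷ []) ∷ [])
    ∷ ((x 0 ∷ y 2 ∷ []) ∷ (y 0 ∷ x 2 ∷ []) ∷ (x 1 ∷ y 1 ∷ []) ∷ (x 3 ∷ x 4 ∷ []) ∷ (y 3 ∷ y 4 ∷ []) ∷ [])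
    ∷ ((x 1 ∷ y 2 ∷ []) ∷ (x 2 ∷ y 4 ∷ []) ∷ (x 3 ∷ y 3 ∷ []) ∷ (x 4 ∷ y 6 ∷ []) ∷ (x 5 ∷ y 5 ∷ []) ∷ [])
    ∷ ((x 0 ∷ y 1 ∷ []) ∷ (x 2 ∷ y 2 ∷ []) ∷ (x 3 ∷ y 5 ∷ []) ∷ (y 3 ∷ x 4 ∷ []) ∷ (y 4 ∷ x 6 ∷ []) ∷ [])
    ∷ [])

pieces-2-1-1-1 : Realisable (2 ∷ 1 ∷ 1 ∷ 1 ∷ [])
pieces-2-1-1-1 = pieces (2 ∷ 1 ∷ 1 ∷ 1 ∷ [])
    ( ((x 1 ∷ x 3 ∷ y 1 ∷ x 2 ∷ []) ∷ (y 2 ∷ y 3 ∷ []) ∷ (x 4 ∷ y 4 ∷ []) ∷ (x 5 ∷ y 5 ∷ []) ∷ [])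
    ∷ ((y 0 ∷ y 2 ∷ y 1 ∷ x 1 ∷ []) ∷ (x 2 ∷ y 4 ∷ []) ∷ (x 3 ∷ y 3 ∷ []) ∷ (x 4 ∷ x 5 ∷ []) ∷ [])
    ∷ ((x 0 ∷ x 1 ∷ []) ∷ (y 0 ∷ x 2 ∷ []) ∷ (y 1 ∷ y 3 ∷ []) ∷ (y 2 ∷ x 4 ∷ x 3 ∷ y 4 ∷ []) ∷ [])
    ∷ ((x 0 ∷ y 2 ∷ x 1 ∷ y 1 ∷ []) ∷ (x 2 ∷ x 4 ∷ []) ∷ (x 3 ∷ y 5 ∷ []) ∷ (y 3 ∷ y 4 ∷ []) ∷ [])
    ∷ ((y 0 ∷ x 1 ∷ x 2 ∷ y 2 ∷ []) ∷ (x 3 ∷ x 5 ∷ []) ∷ (y 3 ∷ x 4 ∷ []) ∷ (y 4 ∷ y 6 ∷ []) ∷ [])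
    ∷ ((y 1 ∷ y 2 ∷ x 3 ∷ x 2 ∷ []) ∷ (y 3 ∷ y 5 ∷ []) ∷ (x 4 ∷ x 6 ∷ []) ∷ (y 4 ∷ x 5 ∷ []) ∷ [])
    ∷ ((x 0 ∷ x 2 ∷ []) ∷ (y 0 ∷ y 1 ∷ []) ∷ (x 1 ∷ y 3 ∷ []) ∷ (y 2 ∷ y 4 ∷ x 3 ∷ x 4 ∷ []) ∷ [])
    ∷ ((x 1 ∷ y 2 ∷ x 2 ∷ x 3 ∷ []) ∷ (y 3 ∷ x 5 ∷ []) ∷ (x 4 ∷ y 6 ∷ []) ∷ (y 4 ∷ y 5 ∷ []) ∷ [])
    ∷ ((x 0 ∷ y 1 ∷ x 3 ∷ y 2 ∷ []) ∷ (x 2 ∷ y 3 ∷ []) ∷ (x 4 ∷ y 5 ∷ []) ∷ (y 4 ∷ x 6 ∷ []) ∷ [])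
    ∷ [])

pieces-2-2-1 : Realisable (2 ∷ 2 ∷ 1 ∷ [])
pieces-2-2-1 = pieces (2 ∷ 2 ∷ 1 ∷ [])
    ( ((x 1 ∷ y 1 ∷ x 2 ∷ y 2 ∷ []) ∷ (x 3 ∷ y 5 ∷ []) ∷ (y 3 ∷ y 4 ∷ x 5 ∷ x 4 ∷ []) ∷ [])
    ∷ ((y 0 ∷ y 2 ∷ y 3 ∷ y 1 ∷ []) ∷ (x 1 ∷ x 2 ∷ []) ∷ (x 3 ∷ x 4 ∷ x 5 ∷ y 4 ∷ []) ∷ [])
    ∷ ((x 0 ∷ x 1 ∷ x 3 ∷ y 1 ∷ []) ∷ (y 0 ∷ x 2 ∷ y 3 ∷ y 2 ∷ []) ∷ (x 4 ∷ y 4 ∷ []) ∷ [])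
    ∷ ((x 0 ∷ y 2 ∷ y 1 ∷ x 1 ∷ []) ∷ (x 2 ∷ x 4 ∷ y 5 ∷ y 4 ∷ []) ∷ (x 3 ∷ y 3 ∷ []) ∷ [])
    ∷ ((y 0 ∷ x 1 ∷ y 3 ∷ x 2 ∷ []) ∷ (y 2 ∷ y 4 ∷ y 6 ∷ x 4 ∷ []) ∷ (x 3 ∷ x 5 ∷ []) ∷ [])
    ∷ ((y 1 ∷ y 2 ∷ x 3 ∷ x 2 ∷ []) ∷ (y 3 ∷ x 4 ∷ x 6 ∷ y 4 ∷ []) ∷ (x 5 ∷ y 5 ∷ []) ∷ [])
    ∷ ((x 0 ∷ x 2 ∷ []) ∷ (y 0 ∷ y 1 ∷ y 3 ∷ x 1 ∷ []) ∷ (y 2 ∷ x 4 ∷ x 3 ∷ y 4 ∷ []) ∷ [])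
    ∷ ((x 1 ∷ y 2 ∷ x 2 ∷ x 3 ∷ []) ∷ (y 3 ∷ x 5 ∷ []) ∷ (x 4 ∷ y 6 ∷ y 4 ∷ y 5 ∷ []) ∷ [])
    ∷ ((x 0 ∷ y 1 ∷ x 3 ∷ y 2 ∷ []) ∷ (x 2 ∷ y 4 ∷ x 6 ∷ x 4 ∷ []) ∷ (y 3 ∷ y 5 ∷ []) ∷ [])
    ∷ [])

pieces-3-1-1 : Realisable (3 ∷ 1 ∷ 1 ∷ [])
pieces-3-1-1 = pieces (3 ∷ 1 ∷ 1 ∷ [])
    ( ((x 1 ∷ y 3 ∷ y 5 ∷ x 4 ∷ y 2 ∷ x 3 ∷ []) ∷ (y 1 ∷ x 2 ∷ []) ∷ (y 4 ∷ x 5 ∷ []) ∷ [])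
    ∷ ((y 0 ∷ x 2 ∷ x 3 ∷ y 2 ∷ y 1 ∷ x 1 ∷ []) ∷ (y 3 ∷ y 4 ∷ []) ∷ (x 4 ∷ x 5 ∷ []) ∷ [])
    ∷ ((x 0 ∷ x 1 ∷ []) ∷ (y 0 ∷ y 1 ∷ []) ∷ (x 2 ∷ y 4 ∷ y 2 ∷ y 3 ∷ x 4 ∷ x 3 ∷ []) ∷ [])
    ∷ ((x 0 ∷ y 1 ∷ x 3 ∷ x 4 ∷ y 3 ∷ y 2 ∷ []) ∷ (x 1 ∷ x 2 ∷ []) ∷ (y 4 ∷ y 5 ∷ []) ∷ [])
    ∷ ((y 0 ∷ x 1 ∷ x 3 ∷ y 4 ∷ x 2 ∷ y 2 ∷ []) ∷ (y 3 ∷ x 5 ∷ []) ∷ (x 4 ∷ y 6 ∷ []) ∷ [])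
    ∷ ((y 1 ∷ y 2 ∷ x 4 ∷ x 6 ∷ y 4 ∷ x 3 ∷ []) ∷ (x 2 ∷ y 3 ∷ []) ∷ (x 5 ∷ y 5 ∷ []) ∷ [])
    ∷ ((x 0 ∷ x 2 ∷ y 0 ∷ y 2 ∷ x 1 ∷ y 1 ∷ []) ∷ (x 3 ∷ y 3 ∷ []) ∷ (x 4 ∷ y 4 ∷ []) ∷ [])
    ∷ ((x 1 ∷ y 2 ∷ x 2 ∷ x 4 ∷ y 5 ∷ y 3 ∷ []) ∷ (x 3 ∷ x 5 ∷ []) ∷ (y 4 ∷ y 6 ∷ []) ∷ [])
    ∷ ((x 0 ∷ y 2 ∷ y 4 ∷ x 6 ∷ x 4 ∷ x 2 ∷ []) ∷ (y 1 ∷ y 3 ∷ []) ∷ (x 3 ∷ y 5 ∷ []) ∷ [])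
    ∷ [])

pieces-3-2 : Realisable (3 ∷ 2 ∷ [])
pieces-3-2 = pieces (3 ∷ 2 ∷ [])
    ( ((x 1 ∷ x 2 ∷ x 4 ∷ x 5 ∷ y 4 ∷ y 2 ∷ []) ∷ (y 1 ∷ y 3 ∷ y 5 ∷ x 3 ∷ []) ∷ [])
    ∷ ((y 0 ∷ x 2 ∷ x 1 ∷ y 1 ∷ []) ∷ (y 2 ∷ y 4 ∷ y 3 ∷ x 5 ∷ x 3 ∷ x 4 ∷ []) ∷ [])
    ∷ ((x 0 ∷ x 1 ∷ y 0 ∷ y 2 ∷ []) ∷ (y 1 ∷ x 2 ∷ x 3 ∷ y 4 ∷ x 4 ∷ y 3 ∷ []) ∷ [])
    ∷ ((x 0 ∷ x 2 ∷ y 2 ∷ y 1 ∷ []) ∷ (x 1 ∷ y 3 ∷ y 4 ∷ y 5 ∷ x 4 ∷ x 3 ∷ []) ∷ [])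
    ∷ ((y 0 ∷ x 1 ∷ x 3 ∷ x 2 ∷ y 3 ∷ y 2 ∷ []) ∷ (x 4 ∷ y 6 ∷ y 4 ∷ x 5 ∷ []) ∷ [])
    ∷ ((y 1 ∷ y 2 ∷ x 4 ∷ x 6 ∷ y 4 ∷ x 2 ∷ []) ∷ (x 3 ∷ y 5 ∷ x 5 ∷ y 3 ∷ []) ∷ [])
    ∷ ((x 0 ∷ y 2 ∷ x 2 ∷ y 0 ∷ y 1 ∷ x 1 ∷ []) ∷ (x 3 ∷ y 3 ∷ x 4 ∷ y 4 ∷ []) ∷ [])
    ∷ ((x 1 ∷ y 2 ∷ x 3 ∷ x 5 ∷ y 5 ∷ y 3 ∷ []) ∷ (x 2 ∷ y 4 ∷ y 6 ∷ x 4 ∷ []) ∷ [])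
    ∷ ((x 0 ∷ y 1 ∷ x 3 ∷ y 2 ∷ y 3 ∷ x 2 ∷ []) ∷ (x 4 ∷ y 5 ∷ y 4 ∷ x 6 ∷ []) ∷ [])
    ∷ [])

pieces-2-2-2 : Realisable (2 ∷ 2 ∷ 2 ∷ [])
pieces-2-2-2 = pieces (2 ∷ 2 ∷ 2 ∷ [])
    ( ((x 1 ∷ y 2 ∷ x 3 ∷ y 1 ∷ []) ∷ (x 2 ∷ y 3 ∷ y 5 ∷ y 4 ∷ []) ∷ (x 4 ∷ y 6 ∷ x 6 ∷ x 5 ∷ []) ∷ [])
    ∷ ((y 0 ∷ y 2 ∷ x 1 ∷ y 1 ∷ []) ∷ (x 2 ∷ x 4 ∷ x 3 ∷ y 3 ∷ []) ∷ (y 4 ∷ x 5 ∷ y 5 ∷ x 6 ∷ []) ∷ [])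
    ∷ ((x 0 ∷ x 1 ∷ y 0 ∷ y 1 ∷ []) ∷ (x 2 ∷ x 3 ∷ y 4 ∷ y 2 ∷ []) ∷ (y 3 ∷ x 4 ∷ y 5 ∷ x 5 ∷ []) ∷ [])
    ∷ ((x 0 ∷ y 1 ∷ x 2 ∷ x 1 ∷ []) ∷ (y 2 ∷ y 4 ∷ y 6 ∷ x 4 ∷ []) ∷ (x 3 ∷ y 5 ∷ y 3 ∷ x 5 ∷ []) ∷ [])
    ∷ ((y 0 ∷ x 1 ∷ x 3 ∷ x 2 ∷ []) ∷ (y 2 ∷ x 4 ∷ y 4 ∷ y 3 ∷ []) ∷ (x 5 ∷ x 6 ∷ y 5 ∷ y 7 ∷ []) ∷ [])
    ∷ ((y 1 ∷ y 3 ∷ x 3 ∷ y 2 ∷ []) ∷ (x 2 ∷ y 4 ∷ x 6 ∷ x 4 ∷ []) ∷ (x 5 ∷ y 6 ∷ y 5 ∷ x 7 ∷ []) ∷ [])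
    ∷ ((x 0 ∷ y 2 ∷ y 0 ∷ x 2 ∷ []) ∷ (x 1 ∷ y 3 ∷ y 1 ∷ x 3 ∷ []) ∷ (x 4 ∷ x 5 ∷ y 4 ∷ y 5 ∷ []) ∷ [])
    ∷ ((x 1 ∷ x 2 ∷ y 2 ∷ y 3 ∷ []) ∷ (x 3 ∷ x 5 ∷ y 7 ∷ y 5 ∷ []) ∷ (x 4 ∷ x 6 ∷ y 6 ∷ y 4 ∷ []) ∷ [])
    ∷ ((x 0 ∷ x 2 ∷ y 1 ∷ y 2 ∷ []) ∷ (x 3 ∷ x 4 ∷ y 3 ∷ y 4 ∷ []) ∷ (x 5 ∷ x 7 ∷ y 5 ∷ y 6 ∷ []) ∷ [])
    ∷ [])

-- Grouping of cycle lengths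

-- Cycles are added one by one; those not yet part of a realisable group form a remainder, which any
-- later group can absorb.
data Remainder : List ℕ → Set where
  none    : Remainder []
  one     : Remainder (1 ∷ [])
  one-one : Remainder (1 ∷ 1 ∷ [])
  two     : Remainder (2 ∷ [])

leftEnd-for : ∀ {r} → Remainder r → LeftEnd r
leftEnd-for none    = leftEnd-0
leftEnd-for one     = leftEnd-1
leftEnd-for one-one = leftEnd-1-1
leftEnd-for two     = leftEnd-2

-- The supply of right ends begins at k = 4; the case k = 3 is therefore tabulated for each
-- remainder.
realisable-long : ∀ n {r} → Remainder r → Realisable (3 + n ∷ r)
realisable-long zero none    = pieces-3
realisable-long zero one     = pieces-3-1
realisable-long zero one-one = pieces-3-1-1
realisable-long zero two     = pieces-3-2
realisable-long (suc n) r    = close (leftEnd-for r) (right n)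

reorder : ∀ {ks ls} → Realisable ks → {True (_↭?_ ℕ._≟_ ks ls)} → Realisable ls
reorder P {p} = realisable-↭ (toWitness p) P

-- Quantifying over all remainders is essential, since the one left over at the end is unknown when
-- the group is formed.
Absorbing : List ℕ → Set
Absorbing ks = ∀ {r} → Remainder r → Realisable (r ++ ks)

-- If `r` and `s` together have sum at most 2, both stay with the long cycle. Otherwise they contain
-- a tabulated list of ones and twos, which is split off; what is left, if anything, stays.
absorbing-long : ∀ n {r} → Remainder r → Absorbing (3 + n ∷ r)
absorbing-long n {r} R {s} S = realisable-↭ (++-comm (3 + n ∷ r) s) (table R S)
  where
  table : ∀ {r s} → Remainder r → Remainder s → Realisable (3 + n ∷ r ++ s)
  table none    S       = realisable-long n S
  table one     none    = realisable-long n one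
  table one     one     = realisable-long n one-one
  table one     one-one = realisable-long n none ⊕ pieces-1-1-1
  table one     two     = realisable-long n none ⊕ reorder pieces-2-1
  table one-one none    = realisable-long n one-one
  table one-one one     = realisable-long n none ⊕ pieces-1-1-1
  table one-one one-one = realisable-long n one ⊕ pieces-1-1-1
  table one-one two     = realisable-long n none ⊕ reorder pieces-2-1-1
  table two     none    = realisable-long n two
  table two     one     = realisable-long n none ⊕ pieces-2-1
  table two     one-one = realisable-long n none ⊕ pieces-2-1-1
  table two     two     = realisable-long n none ⊕ pieces-2-2

absorbing-1-1-1 : Absorbing (1 ∷ 1 ∷ 1 ∷ [])
absorbing-1-1-1 none    = pieces-1-1-1
absorbing-1-1-1 one     = pieces-1-1-1-1
absorbing-1-1-1 one-one = pieces-1-1-1-1-1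
absorbing-1-1-1 two     = pieces-2-1-1-1

absorbing-2-1 : Absorbing (2 ∷ 1 ∷ [])
absorbing-2-1 none    = pieces-2-1
absorbing-2-1 one     = reorder pieces-2-1-1
absorbing-2-1 one-one = reorder pieces-2-1-1-1
absorbing-2-1 two     = pieces-2-2-1

absorbing-2-1-1 : Absorbing (2 ∷ 1 ∷ 1 ∷ [])
absorbing-2-1-1 none    = pieces-2-1-1
absorbing-2-1-1 one     = reorder pieces-2-1-1-1
absorbing-2-1-1 one-one = reorder (pieces-1-1-1 ⊕ pieces-2-1)
absorbing-2-1-1 two     = reorder (pieces-2-1 ⊕ pieces-2-1)

absorbing-2-2 : Absorbing (2 ∷ 2 ∷ [])
absorbing-2-2 none    = pieces-2-2
absorbing-2-2 one     = reorder pieces-2-2-1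
absorbing-2-2 one-one = reorder (pieces-2-1 ⊕ pieces-2-1)
absorbing-2-2 two     = pieces-2-2-2

absorb : ∀ {k r} → 1 ≤ k → Remainder r → Remainder (k ∷ r) ⊎ Absorbing (k ∷ r)
absorb {1} _ none    = inj₁ one
absorb {1} _ one     = inj₁ one-one
absorb {1} _ one-one = inj₂ absorbing-1-1-1
absorb {1} _ two     = inj₂ λ {r} R → realisable-↭ (++⁺ˡ r (swap 2 1 ↭-refl)) (absorbing-2-1 R)
absorb {2} _ none    = inj₁ two
absorb {2} _ one     = inj₂ absorbing-2-1
absorb {2} _ one-one = inj₂ absorbing-2-1-1
absorb {2} _ two     = inj₂ absorbing-2-2
absorb {suc (suc (suc n))} _ R = inj₂ (absorbing-long n R)

-- The latest group `g` is kept apart from the realised rest `ls`, so that it can still take up the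
-- final remainder.
data Grouping : List ℕ → Set where
  short   : ∀ {r} → Remainder r → Grouping r
  grouped : ∀ {ks r g ls} → ks ↭ r ++ g ++ ls →
            Remainder r → Absorbing g → Realisable ls → Grouping ks

grouping : ∀ {ks} → All (1 ≤_) ks → Grouping ks
grouping [] = short none
grouping {k ∷ ks} (1≤k ∷ 1≤ks) with grouping 1≤ks
... | short R with absorb 1≤k R
...   | inj₁ R′ = short R′
...   | inj₂ G  = grouped (↭-reflexive (sym (++-identityʳ (k ∷ ks)))) none G realisable-[]
grouping {k ∷ ks} (1≤k ∷ 1≤ks) | grouped p R G P with absorb 1≤k R
...   | inj₁ R′ = grouped (prep k p) R′ G P
-- The old remainder and `k` form a new group; the previous group is no longer needed in reserve and
-- is realised with the empty remainder.
...   | inj₂ G′ = grouped (prep k p) none G′ (G none ⊕ P)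

realisable : ∀ {ks} → All (1 ≤_) ks → 3 ≤ sum ks → Realisable ks
realisable 1≤ks 3≤sum with grouping 1≤ks
realisable _ ()                        | short none
realisable _ (s≤s ())                  | short one
realisable _ (s≤s (s≤s ()))            | short one-one
realisable _ (s≤s (s≤s ()))            | short two
... | grouped {r = r} {g} {ls} p R G P =
  realisable-↭ (↭-trans (↭-reflexive (++-assoc r g ls)) (↭-sym p)) (G R ⊕ P)

-- Embeddings of F from lists of cycles

applyUpTo-cong : ∀ {f g : ℕ → X} n → (∀ p → p < n → f p ≡ g p) → applyUpTo f n ≡ applyUpTo g n
applyUpTo-cong zero f≗g = refl
applyUpTo-cong (suc n) f≗g = cong₂ _∷_ (f≗g 0 (s≤s z≤n)) (applyUpTo-cong n λ p p<n → f≗g (suc p) (s≤s p<n))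

applyUpTo-+ : ∀ (f : ℕ → X) m n → applyUpTo f (m + n) ≡ applyUpTo f m ++ applyUpTo (λ p → f (m + p)) n
applyUpTo-+ f zero n = refl
applyUpTo-+ f (suc m) n = cong (f 0 ∷_) (applyUpTo-+ (λ p → f (suc p)) m n)

applyUpTo-injective : ∀ (f : ℕ → X) n → Unique (applyUpTo f n) →
  ∀ p q → p < n → q < n → f p ≡ f q → p ≡ q
applyUpTo-injective f (suc n) _ zero zero _ _ _ = refl
applyUpTo-injective f (suc n) (f0∉ ∷ _) zero (suc q) _ (s≤s q<n) eq =
  ⊥-elim (All.lookup f0∉ (∈-applyUpTo⁺ (λ p → f (suc p)) q<n) eq)
applyUpTo-injective f (suc n) (f0∉ ∷ _) (suc p) zero (s≤s p<n) _ eq =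
  ⊥-elim (All.lookup f0∉ (∈-applyUpTo⁺ (λ p → f (suc p)) p<n) (sym eq))
applyUpTo-injective f (suc n) (_ ∷ uniq) (suc p) (suc q) (s≤s p<n) (s≤s q<n) eq =
  cong suc (applyUpTo-injective (λ p → f (suc p)) n uniq p q p<n q<n eq)

Unique-resp-↭ : {xs ys : List X} → xs ↭ ys → Unique xs → Unique ys
Unique-resp-↭ p = Permutationₛ.Unique-resp-↭ (setoid _) (↭⇒↭ₛ p)

Unique-++⁻ʳ : ∀ (xs : List X) {ys} → Unique (xs ++ ys) → Unique ys
Unique-++⁻ʳ [] uniq = uniq
Unique-++⁻ʳ (_ ∷ xs) (_ ∷ uniq) = Unique-++⁻ʳ xs uniq

Unique-++⁻ˡ : ∀ (xs : List X) {ys} → Unique (xs ++ ys) → Unique xs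
Unique-++⁻ˡ [] uniq = []
Unique-++⁻ˡ (_ ∷ xs) (x∉ ∷ uniq) = All.++⁻ˡ xs x∉ ∷ Unique-++⁻ˡ xs uniq

Unique-++⇒Disjoint : ∀ (xs : List X) {ys} → Unique (xs ++ ys) → Disjoint xs ys
Unique-++⇒Disjoint (v ∷ xs) (v∉ ∷ _) (here refl , ∈ys) = All.lookup v∉ (∈-++⁺ʳ xs ∈ys) refl
Unique-++⇒Disjoint (v ∷ xs) (_ ∷ uniq) (there ∈xs , ∈ys) = Unique-++⇒Disjoint xs uniq (∈xs , ∈ys)

∈-concatMap⁺ : ∀ (f : I → List X) {i is v} → i ∈ is → v ∈ f i → v ∈ concatMap f is
∈-concatMap⁺ f (here refl) v∈ = ∈-++⁺ˡ v∈
∈-concatMap⁺ f {is = i ∷ _} (there i∈) v∈ = ∈-++⁺ʳ (f i) (∈-concatMap⁺ f i∈ v∈)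

∈-concatMap⇒∃ : ∀ (f : I → List X) is {v} → v ∈ concatMap f is → ∃ λ i → v ∈ f i
∈-concatMap⇒∃ f (i ∷ is) v∈ with ∈-++⁻ (f i) v∈
... | inj₁ v∈fi = i , v∈fi
... | inj₂ v∈   = ∈-concatMap⇒∃ f is v∈

-- Applied to the arcs of the nine factors, this gives the uniqueness of the factor through a given
-- arc.
concatMap-index-unique : ∀ (f : I → List X) is → Unique (concatMap f is) →
  ∀ {i j v} → i ∈ is → j ∈ is → v ∈ f i → v ∈ f j → i ≡ j
concatMap-index-unique f (i ∷ is) uniq (here refl) (here refl) _ _ = refl
concatMap-index-unique f (i ∷ is) uniq (here refl) (there j∈) v∈i v∈j =
  ⊥-elim (Unique-++⇒Disjoint (f i) uniq (v∈i , ∈-concatMap⁺ f j∈ v∈j))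
concatMap-index-unique f (i ∷ is) uniq (there i∈) (here refl) v∈i v∈j =
  ⊥-elim (Unique-++⇒Disjoint (f i) uniq (v∈j , ∈-concatMap⁺ f i∈ v∈i))
concatMap-index-unique f (i ∷ is) uniq (there i∈) (there j∈) v∈i v∈j =
  concatMap-index-unique f is (Unique-++⁻ʳ (f i) uniq) i∈ j∈ v∈i v∈j

-- The value beyond the end of the list is never used.
at : List Vertex → ℕ → Vertex
at [] _ = x 0
at (v ∷ vs) zero = v
at (v ∷ vs) (suc p) = at vs p

applyUpTo-at : ∀ vs → applyUpTo (at vs) (length vs) ≡ vs
applyUpTo-at [] = refl
applyUpTo-at (v ∷ vs) = cong (v ∷_) (applyUpTo-at vs)

at-++ˡ : ∀ vs ws {p} → p < length vs → at (vs ++ ws) p ≡ at vs p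
at-++ˡ (v ∷ vs) ws {zero} _ = refl
at-++ˡ (v ∷ vs) ws {suc p} (s≤s p<l) = at-++ˡ vs ws p<l

at-++ʳ : ∀ vs ws p → at (vs ++ ws) (length vs + p) ≡ at ws p
at-++ʳ [] ws p = refl
at-++ʳ (v ∷ vs) ws p = at-++ʳ vs ws p

<⇒<ᵇ≡true : ∀ {p l} → p < l → (p <ᵇ l) ≡ true
<⇒<ᵇ≡true {zero} (s≤s _) = refl
<⇒<ᵇ≡true {suc p} (s≤s p<l) = <⇒<ᵇ≡true p<l

m+n<ᵇm≡false : ∀ m n → (m + n <ᵇ m) ≡ false
m+n<ᵇm≡false zero n = refl
m+n<ᵇm≡false (suc m) n = m+n<ᵇm≡false m n

next : ℕ → ℕ → ℕ
next l p = if suc p <ᵇ l then suc p else 0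

next< : ∀ {l p} → p < l → next l p < l
next< {l} {p} p<l with suc p <ᵇ l in eq
... | true  = ℕ.<ᵇ⇒< (suc p) l (subst T (sym eq) _)
... | false = ℕ.≤-<-trans z≤n p<l

succF-here : ∀ l ls {p} → p < l → succF (l ∷ ls) p ≡ next l p
succF-here l ls {p} p<l rewrite <⇒<ᵇ≡true p<l = refl

succF-there : ∀ l ls p → succF (l ∷ ls) (l + p) ≡ l + succF ls p
succF-there l ls p rewrite m+n<ᵇm≡false l p | ℕ.m+n∸m≡n l p = refl

walk-at : ∀ u vs w → walk u vs w ≡
  applyUpTo (λ p → at (u ∷ vs) p , (if p <ᵇ length vs then at vs p else w)) (suc (length vs))
walk-at u [] w = refl
walk-at u (v ∷ vs) w = cong ((u , v) ∷_) (walk-at v vs w)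

arcs-at : ∀ vs → arcs vs ≡ applyUpTo (λ p → at vs p , at vs (next (length vs) p)) (length vs)
arcs-at [] = refl
arcs-at (v ∷ vs) = trans (walk-at v vs v)
  (applyUpTo-cong (suc (length vs)) λ p _ → cong (at (v ∷ vs) p ,_) (sym (Bool.if-float (at (v ∷ vs)) (p <ᵇ length vs) {suc p} {0})))

-- Concatenation lays the cycles out in the consecutive blocks on which `succF` acts, so their arcs
-- are those of F read through `at`.
cycles-at : ∀ cs → let ls = map length cs; vs = concat cs in
  concatMap arcs cs ≡ applyUpTo (λ p → at vs p , at vs (succF ls p)) (sumL ls)
cycles-at [] = refl
cycles-at (c ∷ cs) = sym (begin
  applyUpTo step (l + sumL ls)
    ≡⟨ applyUpTo-+ step l (sumL ls) ⟩
  applyUpTo step l ++ applyUpTo (λ p → step (l + p)) (sumL ls)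
    ≡⟨ cong₂ _++_ (applyUpTo-cong l within) (applyUpTo-cong (sumL ls) λ p _ → beyond p) ⟩
  applyUpTo (λ p → at c p , at c (next l p)) l ++ applyUpTo (λ p → at vs p , at vs (succF ls p)) (sumL ls)
    ≡⟨ cong₂ _++_ (sym (arcs-at c)) (sym (cycles-at cs)) ⟩
  arcs c ++ concatMap arcs cs ∎)
  where
  open ≡-Reasoning
  l = length c
  ls = map length cs
  vs = concat cs
  step : ℕ → Arc
  step p = at (c ++ vs) p , at (c ++ vs) (succF (l ∷ ls) p)
  within : ∀ p → p < l → step p ≡ (at c p , at c (next l p))
  within p p<l = cong₂ _,_ (at-++ˡ c vs p<l)
    (trans (cong (at (c ++ vs)) (succF-here l ls p<l)) (at-++ˡ c vs (next< p<l)))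
  beyond : ∀ p → step (l + p) ≡ (at vs p , at vs (succF ls p))
  beyond p = cong₂ _,_ (at-++ʳ c vs p)
    (trans (cong (at (c ++ vs)) (succF-there l ls p)) (at-++ʳ c vs (succF ls p)))

length-concat : ∀ (cs : List (List X)) → length (concat cs) ≡ sumL (map length cs)
length-concat [] = refl
length-concat (c ∷ cs) = trans (length-++ c) (cong (length c +_) (length-concat cs))

-- The strips are the columns and the arcs of J*

column : Vertex → ℕ
column = proj₂

shiftᵛ-injective : ∀ k {u v} → shiftᵛ k u ≡ shiftᵛ k v → u ≡ v
shiftᵛ-injective k eq = cong₂ _,_ (cong proj₁ eq) (ℕ.+-cancelˡ-≡ k _ _ (cong proj₂ eq))

∈-vertices⇒column< : ∀ m {v} → v ∈ 𝕍.strip m → column v < m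
∈-vertices⇒column< (suc m) (here refl) = s≤s z≤n
∈-vertices⇒column< (suc m) (there (here refl)) = s≤s z≤n
∈-vertices⇒column< (suc m) (there (there v∈)) with ∈-map⁻ (shiftᵛ 1) v∈
... | _ , u∈ , refl = s≤s (∈-vertices⇒column< m u∈)

column<⇒∈-vertices : ∀ m {v} → column v < m → v ∈ 𝕍.strip m
column<⇒∈-vertices (suc m) {false , zero} _ = here refl
column<⇒∈-vertices (suc m) {true , zero} _ = there (here refl)
column<⇒∈-vertices (suc m) {a , suc i} (s≤s i<m) =
  there (there (∈-map⁺ (shiftᵛ 1) (column<⇒∈-vertices m i<m)))

vertices-unique : ∀ m → Unique (𝕍.strip m)
vertices-unique zero = []
vertices-unique (suc m) = Unique.++⁺ (from-yes (unique? _≟ᵛ_ (x 0 ∷ y 0 ∷ [])))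
  (Unique.map⁺ (shiftᵛ-injective 1) (vertices-unique m)) λ (∈unit , ∈shift) → apart ∈unit (∈-map⁻ (shiftᵛ 1) ∈shift)
  where
  apart : ∀ {v} → v ∈ x 0 ∷ y 0 ∷ [] → ¬ (∃ λ u → u ∈ 𝕍.strip m × v ≡ shiftᵛ 1 u)
  apart (here refl) (_ , _ , ())
  apart (there (here refl)) (_ , _ , ())

-- JEdge and JArc with plain columns: JArc m u v is definitionally JArcᵛ m (fromVtx u) (fromVtx v).
JEdgeᵛ JArcᵛ : ℕ → Vertex → Vertex → Set
JEdgeᵛ m (a , i) (b , j) =
    (i ≡ j × 1 ≤ i × i ≤ m × a ≢ b)
  ⊎ (j ≡ suc i × i < m)
  ⊎ (j ≡ suc (suc i) × i < m)
JArcᵛ m u v = JEdgeᵛ m u v ⊎ JEdgeᵛ m v u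

JEdge-shift : ∀ {m u v} → JEdgeᵛ m u v → JEdgeᵛ (suc m) (shiftᵛ 1 u) (shiftᵛ 1 v)
JEdge-shift (inj₁ (i≡j , _ , i≤m , a≢b)) = inj₁ (cong suc i≡j , s≤s z≤n , s≤s i≤m , a≢b)
JEdge-shift (inj₂ (inj₁ (eq , i<m))) = inj₂ (inj₁ (cong suc eq , s≤s i<m))
JEdge-shift (inj₂ (inj₂ (eq , i<m))) = inj₂ (inj₂ (cong suc eq , s≤s i<m))

unit-JArc : ∀ m → All (λ (u , v) → JArcᵛ (suc m) u v) unitArcs
unit-JArc m = All.++⁺ (All.map inj₁ edge) (All.map⁺ (All.map inj₂ edge))
  where
  near : ∀ {a b} → JEdgeᵛ (suc m) (a , 0) (b , 1)
  near = inj₂ (inj₁ (refl , s≤s z≤n))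
  far : ∀ {a b} → JEdgeᵛ (suc m) (a , 0) (b , 2)
  far = inj₂ (inj₂ (refl , s≤s z≤n))
  edge : All (λ (u , v) → JEdgeᵛ (suc m) u v) edges
  edge = inj₁ (refl , s≤s z≤n , s≤s z≤n , λ ())
    ∷ near ∷ near ∷ near ∷ near ∷ far ∷ far ∷ far ∷ far ∷ []

∈-arcs⇒JArc : ∀ m {u v} → (u , v) ∈ 𝔸.strip m → JArcᵛ m u v
∈-arcs⇒JArc (suc m) uv∈ with ∈-++⁻ unitArcs uv∈
... | inj₁ ∈unit = All.lookup (unit-JArc m) ∈unit
... | inj₂ ∈shift with ∈-map⁻ (shiftᵃ 1) ∈shift
...   | (u , v) , uv∈m , refl with ∈-arcs⇒JArc m uv∈m
...     | inj₁ uv = inj₁ (JEdge-shift uv)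
...     | inj₂ vu = inj₂ (JEdge-shift vu)

JEdge⇒∈-arcs : ∀ m {u v} → JEdgeᵛ m u v → (u , v) ∈ 𝔸.strip m × (v , u) ∈ 𝔸.strip m
JEdge⇒∈-arcs zero (inj₁ (refl , () , z≤n , _))
JEdge⇒∈-arcs zero (inj₂ (inj₁ (_ , ())))
JEdge⇒∈-arcs zero (inj₂ (inj₂ (_ , ())))
JEdge⇒∈-arcs (suc m) {u} {v} = cases u v
  where
  open DecMembership _≟ᵃ_ using (_∈?_)
  unit : ∀ u v → {True ((u , v) ∈? unitArcs)} → {True ((v , u) ∈? unitArcs)} →
         (u , v) ∈ 𝔸.strip (suc m) × (v , u) ∈ 𝔸.strip (suc m)
  unit u v {p} {q} = ∈-++⁺ˡ (toWitness p) , ∈-++⁺ˡ (toWitness q)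
  later : ∀ {u v} → JEdgeᵛ m u v →
    (shiftᵛ 1 u , shiftᵛ 1 v) ∈ 𝔸.strip (suc m) × (shiftᵛ 1 v , shiftᵛ 1 u) ∈ 𝔸.strip (suc m)
  later uv = let p , q = JEdge⇒∈-arcs m uv in
    ∈-++⁺ʳ unitArcs (∈-map⁺ (shiftᵃ 1) p) , ∈-++⁺ʳ unitArcs (∈-map⁺ (shiftᵃ 1) q)
  cases : ∀ u v → JEdgeᵛ (suc m) u v → (u , v) ∈ 𝔸.strip (suc m) × (v , u) ∈ 𝔸.strip (suc m)
  cases (_ , suc (suc i)) _ (inj₁ (refl , _ , s≤s i<m , a≢b)) = later (inj₁ (refl , s≤s z≤n , i<m , a≢b))
  cases (false , 1) (false , _) (inj₁ (refl , _ , _ , a≢b)) = ⊥-elim (a≢b refl)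
  cases (false , 1) (true , _) (inj₁ (refl , _)) = unit (x 1) (y 1)
  cases (true , 1) (false , _) (inj₁ (refl , _)) = unit (y 1) (x 1)
  cases (true , 1) (true , _) (inj₁ (refl , _ , _ , a≢b)) = ⊥-elim (a≢b refl)
  cases (_ , zero) _ (inj₁ (_ , () , _))
  cases (_ , suc i) _ (inj₂ (inj₁ (refl , s≤s i<m))) = later (inj₂ (inj₁ (refl , i<m)))
  cases (false , zero) (false , _) (inj₂ (inj₁ (refl , _))) = unit (x 0) (x 1)
  cases (false , zero) (true , _) (inj₂ (inj₁ (refl , _))) = unit (x 0) (y 1)
  cases (true , zero) (false , _) (inj₂ (inj₁ (refl , _))) = unit (y 0) (x 1)
  cases (true , zero) (true , _) (inj₂ (inj₁ (refl , _))) = unit (y 0) (y 1)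
  cases (_ , suc i) _ (inj₂ (inj₂ (refl , s≤s i<m))) = later (inj₂ (inj₂ (refl , i<m)))
  cases (false , zero) (false , _) (inj₂ (inj₂ (refl , _))) = unit (x 0) (x 2)
  cases (false , zero) (true , _) (inj₂ (inj₂ (refl , _))) = unit (x 0) (y 2)
  cases (true , zero) (false , _) (inj₂ (inj₂ (refl , _))) = unit (y 0) (x 2)
  cases (true , zero) (true , _) (inj₂ (inj₂ (refl , _))) = unit (y 0) (y 2)

JArc⇒∈-arcs : ∀ m {u v} → JArcᵛ m u v → (u , v) ∈ 𝔸.strip m
JArc⇒∈-arcs m (inj₁ uv) = proj₁ (JEdge⇒∈-arcs m uv)
JArc⇒∈-arcs m (inj₂ vu) = proj₂ (JEdge⇒∈-arcs m vu)

-- Separates the translated units from the first one.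
Later : Arc → Set
Later ((_ , i) , (_ , j)) = 1 ≤ i × 1 ≤ j × 3 ≤ i + j

-- The columns of an arc of J* add up to at least 1, as vertical edges begin at column 1;
-- translation adds 2. In the unit, an arc either touches column 0 or joins x_1 and y_1, with sum 2.
shift-later : ∀ {m u v} → JArcᵛ m u v → Later (shiftᵃ 1 (u , v))
shift-later {u = _ , i} {v = _ , j} uv = s≤s z≤n , s≤s z≤n , s≤s (ℕ.≤-trans (s≤s (bound uv)) (ℕ.≤-reflexive (sym (ℕ.+-suc i j))))
  where
  bound : ∀ {m u v} → JArcᵛ m u v → 1 ≤ column u + column v
  bound (inj₁ (inj₁ (_ , 1≤i , _))) = ℕ.m≤n⇒m≤n+o _ 1≤i
  bound {u = u} (inj₁ (inj₂ (inj₁ (refl , _)))) = ℕ.m≤n⇒m≤o+n (column u) (s≤s z≤n)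
  bound {u = u} (inj₁ (inj₂ (inj₂ (refl , _)))) = ℕ.m≤n⇒m≤o+n (column u) (s≤s z≤n)
  bound {u = u} (inj₂ (inj₁ (_ , 1≤j , _))) = ℕ.m≤n⇒m≤o+n (column u) 1≤j
  bound (inj₂ (inj₂ (inj₁ (refl , _)))) = s≤s z≤n
  bound (inj₂ (inj₂ (inj₂ (refl , _)))) = s≤s z≤n

arcs-unique : ∀ m → Unique (𝔸.strip m)
arcs-unique zero = []
arcs-unique (suc m) = Unique.++⁺ (from-yes (unique? _≟ᵃ_ unitArcs))
  (Unique.map⁺ (λ eq → cong₂ _,_ (shiftᵛ-injective 1 (cong proj₁ eq)) (shiftᵛ-injective 1 (cong proj₂ eq))) (arcs-unique m))
  λ (∈unit , ∈shift) → apart ∈unit (∈-map⁻ (shiftᵃ 1) ∈shift)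
  where
  later? : ∀ e → Dec (Later e)
  later? ((_ , i) , (_ , j)) = (1 ℕ.≤? i) ×-dec (1 ℕ.≤? j) ×-dec (3 ℕ.≤? i + j)
  apart : ∀ {e} → e ∈ unitArcs → ¬ (∃ λ d → d ∈ 𝔸.strip m × e ≡ shiftᵃ 1 d)
  apart ∈unit (d , d∈ , refl) =
    All.lookup (from-yes (All.all? (λ e → ¬? (later? e)) unitArcs)) ∈unit (shift-later (∈-arcs⇒JArc m d∈))

-- Bounded and unbounded columns

clamp : ∀ n → ℕ → Fin (suc n)
clamp zero _ = zero
clamp (suc n) zero = zero
clamp (suc n) (suc i) = suc (clamp n i)

toℕ-clamp : ∀ n {i} → i ≤ n → toℕ (clamp n i) ≡ i
toℕ-clamp zero z≤n = refl
toℕ-clamp (suc n) {zero} _ = refl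
toℕ-clamp (suc n) {suc i} (s≤s i≤n) = cong suc (toℕ-clamp n i≤n)

clamp-toℕ : ∀ n (i : Fin (suc n)) → clamp n (toℕ i) ≡ i
clamp-toℕ zero zero = refl
clamp-toℕ (suc n) zero = refl
clamp-toℕ (suc n) (suc i) = cong suc (clamp-toℕ n i)

toVtx : ∀ m → Vertex → Vtx m
toVtx m (a , i) = a , clamp (suc m) i

fromVtx : ∀ {m} → Vtx m → Vertex
fromVtx (a , i) = a , toℕ i

fromVtx-toVtx : ∀ m {v} → column v ≤ suc m → fromVtx (toVtx m v) ≡ v
fromVtx-toVtx m {a , i} i≤ = cong (a ,_) (toℕ-clamp (suc m) i≤)

toVtx-fromVtx : ∀ m (v : Vtx m) → toVtx m (fromVtx v) ≡ v
toVtx-fromVtx m (a , i) = cong (a ,_) (clamp-toℕ (suc m) i)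

-- Each vertex of a factor is the start of an arc, so this bound shows that `clamp` never alters a
-- vertex of a factor.
JArc⇒column≤ : ∀ {m u v} → JArcᵛ m u v → column u ≤ suc m
JArc⇒column≤ (inj₁ (inj₁ (_ , _ , i≤m , _))) = ℕ.m≤n⇒m≤1+n i≤m
JArc⇒column≤ (inj₁ (inj₂ (inj₁ (_ , i<m)))) = ℕ.m≤n⇒m≤1+n (ℕ.<⇒≤ i<m)
JArc⇒column≤ (inj₁ (inj₂ (inj₂ (_ , i<m)))) = ℕ.m≤n⇒m≤1+n (ℕ.<⇒≤ i<m)
JArc⇒column≤ (inj₂ (inj₁ (refl , _ , i≤m , _))) = ℕ.m≤n⇒m≤1+n i≤m
JArc⇒column≤ (inj₂ (inj₂ (inj₁ (refl , i<m)))) = ℕ.m≤n⇒m≤1+n i<m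
JArc⇒column≤ (inj₂ (inj₂ (inj₂ (refl , i<m)))) = s≤s i<m

-- From pieces to an admissible decomposition

omitted-column< : ∀ j → All (λ v → column v < 2) (omitted j)
omitted-column< = from-yes (all? λ j → All.all? (λ v → column v ℕ.<? 2) (omitted j))

omitted-unique : ∀ j → Unique (omitted j)
omitted-unique = from-yes (all? λ j → unique? _≟ᵛ_ (omitted j))

-- The lengths now have to agree with `ls` in order, because `succF ls` fixes the blocks. The bound
-- on `m` separates columns 0 and 1 from columns m and m+1.
module Conversion {m} (2≤m : 2 ≤ m) (ls : List ℕ)
  (cycles    : Fin 9 → List (List Vertex))
  (lengths   : ∀ j → map length (cycles j) ≡ ls)
  (vertices  : ∀ j → 𝕍.Tiles m (concat (cycles j)) (omitted j) (omitted j))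
  (partition : 𝔸.Tiles m (⨁ λ j → concatMap arcs (cycles j)) [] [])
  where

  n : ℕ
  n = sumL ls

  verts : Fin 9 → List Vertex
  verts j = concat (cycles j)

  step : Fin 9 → ℕ → Arc
  step j p = at (verts j) p , at (verts j) (succF ls p)

  φ : Fin 9 → ℕ → Vtx m
  φ j p = toVtx m (at (verts j) p)

  arcs≡ : ∀ j → concatMap arcs (cycles j) ≡ applyUpTo (step j) n
  arcs≡ j = subst (λ ls → concatMap arcs (cycles j)
                 ≡ applyUpTo (λ p → at (verts j) p , at (verts j) (succF ls p)) (sumL ls))
               (lengths j) (cycles-at (cycles j))

  verts≡ : ∀ j → applyUpTo (at (verts j)) n ≡ verts j
  verts≡ j = trans (cong (applyUpTo (at (verts j))) (sym (trans (length-concat (cycles j)) (cong sumL (lengths j)))))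
                   (applyUpTo-at (verts j))

  all-vertices : ∀ j → verts j ++ omitted j ↭ 𝕍.strip m ++ map (shiftᵛ m) (omitted j)
  all-vertices j = 𝕍.Tiles.fits (vertices j)

  all-arcs : (⨁ λ j → applyUpTo (step j) n) ↭ 𝔸.strip m
  all-arcs = ↭-trans (↭-reflexive (trans (⨁-cong (λ j → sym (arcs≡ j))) (sym (++-identityʳ _))))
    (↭-trans (𝔸.Tiles.fits partition) (↭-reflexive (++-identityʳ _)))

  all-arcs-unique : Unique (⨁ λ j → applyUpTo (step j) n)
  all-arcs-unique = Unique-resp-↭ (↭-sym all-arcs) (arcs-unique m)

  strip-shift-disjoint : ∀ j → Disjoint (𝕍.strip m) (map (shiftᵛ m) (omitted j))
  strip-shift-disjoint j (∈strip , ∈shift) with ∈-map⁻ (shiftᵛ m) ∈shift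
  ... | u , _ , refl = ℕ.m+n≮m m (column u) (∈-vertices⇒column< m ∈strip)

  all-vertices-unique : ∀ j → Unique (verts j ++ omitted j)
  all-vertices-unique j = Unique-resp-↭ (↭-sym (all-vertices j))
    (Unique.++⁺ (vertices-unique m) (Unique.map⁺ (shiftᵛ-injective m) (omitted-unique j)) (strip-shift-disjoint j))

  at-injective : ∀ j p q → p < n → q < n → at (verts j) p ≡ at (verts j) q → p ≡ q
  at-injective j = applyUpTo-injective (at (verts j)) n
    (subst Unique (sym (verts≡ j)) (Unique-++⁻ˡ (verts j) (all-vertices-unique j)))

  step-arc : ∀ j {p} → p < n → JArcᵛ m (at (verts j) p) (at (verts j) (succF ls p))
  step-arc j p<n = ∈-arcs⇒JArc m (∈-resp-↭ all-arcs
    (∈-concatMap⁺ (λ j → applyUpTo (step j) n) (∈-allFin j) (∈-applyUpTo⁺ (step j) p<n)))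

  from-φ : ∀ j {p} → p < n → fromVtx (φ j p) ≡ at (verts j) p
  from-φ j p<n = fromVtx-toVtx m (JArc⇒column≤ (step-arc j p<n))

  from-φ-next : ∀ j {p} → p < n → fromVtx (φ j (succF ls p)) ≡ at (verts j) (succF ls p)
  from-φ-next j p<n = fromVtx-toVtx m (JArc⇒column≤ (Sum.swap (step-arc j p<n)))

  isCopy : ∀ j → IsCopy m ls (φ j)
  isCopy j =
      (λ p q p<n q<n eq → at-injective j p q p<n q<n
         (trans (sym (from-φ j p<n)) (trans (cong fromVtx eq) (from-φ j q<n))))
    , (λ p p<n → subst (λ (u , v) → JArcᵛ m u v)
         (cong₂ _,_ (sym (from-φ j p<n)) (sym (from-φ-next j p<n))) (step-arc j p<n))

  ∈verts⇒InImage : ∀ j v → fromVtx v ∈ verts j → InImage m n (φ j) v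
  ∈verts⇒InImage j v v∈ with ∈-applyUpTo⁻ (at (verts j)) (subst (fromVtx v ∈_) (sym (verts≡ j)) v∈)
  ... | p , p<n , eq = p , p<n , trans (cong (toVtx m) (sym eq)) (toVtx-fromVtx m v)

  InImage⇒∈verts : ∀ j v → InImage m n (φ j) v → fromVtx v ∈ verts j
  InImage⇒∈verts j v (p , p<n , refl) =
    subst (_∈ verts j) (sym (from-φ j p<n)) (subst (at (verts j) p ∈_) (verts≡ j) (∈-applyUpTo⁺ (at (verts j)) p<n))

  -- Everything is read off `all-vertices`. If `u` is omitted, its translate occurs on the right,
  -- hence on the left, and lies too far right to be omitted itself. If not, `u` is in the strip,
  -- hence in the factor, and its translate could occur on the right only as that of an omitted
  -- vertex, which would be `u`.
  exactlyOne : ∀ j (u v : Vtx m) → column (fromVtx u) < 2 → fromVtx v ≡ shiftᵛ m (fromVtx u) →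
    ExactlyOne (InImage m n (φ j) u) (InImage m n (φ j) v)
  exactlyOne j u v u<2 v≡ with fromVtx u ∈? omitted j
    where open DecMembership _≟ᵛ_ using (_∈?_)
  ... | yes u∈ = inj₂
    ( (λ u-in → Unique-++⇒Disjoint (verts j) (all-vertices-unique j) (InImage⇒∈verts j u u-in , u∈))
    , ∈verts⇒InImage j v (subst (_∈ verts j) (sym v≡) shifted∈) )
    where
    shifted∈ : shiftᵛ m (fromVtx u) ∈ verts j
    shifted∈ with ∈-++⁻ (verts j) (∈-resp-↭ (↭-sym (all-vertices j)) (∈-++⁺ʳ (𝕍.strip m) (∈-map⁺ (shiftᵛ m) u∈)))
    ... | inj₁ ∈verts = ∈verts
    ... | inj₂ ∈omitted = ⊥-elim (ℕ.<⇒≱ (All.lookup (omitted-column< j) ∈omitted) (ℕ.m≤n⇒m≤n+o _ 2≤m))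
  ... | no u∉ = inj₁
    ( ∈verts⇒InImage j u u∈verts
    , λ v-in → v∉ (∈-resp-↭ (all-vertices j) (∈-++⁺ˡ (subst (_∈ verts j) v≡ (InImage⇒∈verts j v v-in)))) )
    where
    u∈verts : fromVtx u ∈ verts j
    u∈verts with ∈-++⁻ (verts j) (∈-resp-↭ (↭-sym (all-vertices j))
                   (∈-++⁺ˡ (column<⇒∈-vertices m (ℕ.<-≤-trans u<2 2≤m))))
    ... | inj₁ ∈verts = ∈verts
    ... | inj₂ ∈omitted = ⊥-elim (u∉ ∈omitted)
    v∉ : shiftᵛ m (fromVtx u) ∉ 𝕍.strip m ++ map (shiftᵛ m) (omitted j)
    v∉ v∈ with ∈-++⁻ (𝕍.strip m) v∈
    ... | inj₁ ∈strip = ℕ.m+n≮m m _ (∈-vertices⇒column< m ∈strip)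
    ... | inj₂ ∈shift with ∈-map⁻ (shiftᵛ m) ∈shift
    ...   | w , w∈ , eq = u∉ (subst (_∈ omitted j) (shiftᵛ-injective m (sym eq)) w∈)

  admissible : ∀ j → Admissible m ls (φ j)
  admissible j = first , second , first , second
    where
    pair : ∀ {a i i′} (i< : i < 2 + m) (i′< : i′ < 2 + m) → i < 2 → i′ ≡ m + i →
      ExactlyOne (InImage m n (φ j) (a , fromℕ< i<)) (InImage m n (φ j) (a , fromℕ< i′<))
    pair {a} i< i′< i<2 eq = exactlyOne j (a , fromℕ< i<) (a , fromℕ< i′<)
      (subst (_< 2) (sym (toℕ-fromℕ< i<)) i<2)
      (cong (a ,_) (trans (toℕ-fromℕ< i′<) (trans eq (cong (m +_) (sym (toℕ-fromℕ< i<))))))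
    first : ∀ {a} → ExactlyOne (InImage m n (φ j) (a , fromℕ< (s≤s z≤n)))
                               (InImage m n (φ j) (a , fromℕ< (ℕ.m≤n⇒m≤1+n (ℕ.n<1+n m))))
    first = pair (s≤s z≤n) (ℕ.m≤n⇒m≤1+n (ℕ.n<1+n m)) (s≤s z≤n) (sym (ℕ.+-identityʳ m))
    second : ∀ {a} → ExactlyOne (InImage m n (φ j) (a , fromℕ< (s≤s (s≤s z≤n))))
                                (InImage m n (φ j) (a , fromℕ< (ℕ.n<1+n (suc m))))
    second = pair (s≤s (s≤s z≤n)) (ℕ.n<1+n (suc m)) (s≤s (s≤s z≤n)) (ℕ.+-comm 1 m)

  decomposition : AdmissibleDecomposition m ls
  decomposition = 9 , φ , (λ j → isCopy j , admissible j) , cover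
    where
    cover : ∀ u v → JArc m u v → Σ (Fin 9 × ℕ) λ (j , p) →
        (p < n × φ j p ≡ u × φ j (succF ls p) ≡ v)
      × (∀ j′ p′ → p′ < n → φ j′ p′ ≡ u → φ j′ (succF ls p′) ≡ v → j′ ≡ j × p′ ≡ p)
    cover u v uv with ∈-concatMap⇒∃ (λ j → applyUpTo (step j) n) (allFin 9)
                        (∈-resp-↭ (↭-sym all-arcs) (JArc⇒∈-arcs m uv))
    ... | j , uv∈ with ∈-applyUpTo⁻ (step j) uv∈
    ...   | p , p<n , eq = (j , p)
            , (p<n , trans (cong (toVtx m) (sym (cong proj₁ eq))) (toVtx-fromVtx m u)
                   , trans (cong (toVtx m) (sym (cong proj₂ eq))) (toVtx-fromVtx m v))
            , unique
      where
      unique : ∀ j′ p′ → p′ < n → φ j′ p′ ≡ u → φ j′ (succF ls p′) ≡ v → j′ ≡ j × p′ ≡ p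
      unique j′ p′ p′<n eq₁ eq₂ with
        concatMap-index-unique (λ j → applyUpTo (step j) n) (allFin 9) all-arcs-unique
          (∈-allFin j′) (∈-allFin j)
          (subst (_∈ applyUpTo (step j′) n)
            (cong₂ _,_ (trans (sym (from-φ j′ p′<n)) (cong fromVtx eq₁))
                       (trans (sym (from-φ-next j′ p′<n)) (cong fromVtx eq₂)))
            (∈-applyUpTo⁺ (step j′) p′<n))
          uv∈
      -- Within one factor the initial vertex of the arc already determines the position.
      ... | refl = refl , at-injective j p′ p p′<n p<n
              (trans (sym (from-φ j p′<n)) (trans (cong fromVtx eq₁) (cong proj₁ eq)))

-- A permutation of the lengths lifts to one of the cycles (`↭-map-inv`), and neither tiling
-- condition depends on the order of the cycles.
Pieces⇒decomposition : ∀ {m ks ls} → 2 ≤ m → ls ≡ map (2 *_) ks → Pieces m ks → AdmissibleDecomposition m ls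
Pieces⇒decomposition {m} {ks} {ls} 2≤m refl P =
  Conversion.decomposition 2≤m ls cycles (λ j → sym (proj₁ (proj₂ (ordered j))))
    (λ j → 𝕍.tiles-resp-↭ (↭-concat j) (P.vertices j))
    (𝔸.tiles-resp-↭ (concatMap-cong-↭ (λ j → concatMap-↭ arcs (proj₂ (proj₂ (ordered j)))) (allFin 9)) P.partition)
  where
  module P = Pieces P
  ordered : ∀ j → ∃ λ cs → map (2 *_) ks ≡ map length cs × P.cycles j ↭ cs
  ordered j = ↭-map-inv length (P.lengths j)
  cycles : Fin 9 → List (List Vertex)
  cycles j = proj₁ (ordered j)
  ↭-concat : ∀ j → concat (P.cycles j) ↭ concat (cycles j)
  ↭-concat j = subst₂ _↭_ (cong concat (map-id (P.cycles j))) (cong concat (map-id (cycles j)))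
    (concatMap-↭ (λ c → c) (proj₂ (proj₂ (ordered j))))

-- Halving the lengths, and the conclusion

halve : ∀ {ls} → All (λ l → 2 ≤ l) ls → All (λ l → 2 ∣ l) ls →
  ∃ λ ks → ls ≡ map (2 *_) ks × All (1 ≤_) ks
halve [] [] = [] , refl , []
halve (2≤l ∷ 2≤ls) (divides k refl ∷ 2∣ls) with halve 2≤ls 2∣ls
... | ks , refl , 1≤ks = k ∷ ks , cong (_∷ map (2 *_) ks) (ℕ.*-comm k 2)
                       , ℕ.*-cancelʳ-≤ 1 k 2 2≤l ∷ 1≤ks

sumL-double : ∀ ks → sumL (map (2 *_) ks) ≡ 2 * sum ks
sumL-double [] = refl
sumL-double (k ∷ ks) = trans (cong (2 * k +_) (sumL-double ks)) (sym (ℕ.*-distribˡ-+ 2 k (sum ks)))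

theorem4p21 : (m : ℕ) → 4 ≤ m → (ls : List ℕ) →
    All (λ l → 2 ≤ l) ls → All (λ l → 2 ∣ l) ls →
    sumL ls ≡ 2 * m → ¬ All (λ l → l ≡ 2) ls →
    AdmissibleDecomposition m ls
theorem4p21 m 4≤m ls 2≤ls 2∣ls sum≡2m _ with halve 2≤ls 2∣ls
... | ks , refl , 1≤ks
  -- The order 2m of F makes m the sum of the halved lengths, which is the number of columns of the
  -- pieces.
  with refl ← ℕ.*-cancelˡ-≡ (sum ks) m 2 (trans (sym (sumL-double ks)) sum≡2m) =
  Pieces⇒decomposition (ℕ.≤-trans (s≤s (s≤s z≤n)) 4≤m) refl
    (realisable 1≤ks (ℕ.≤-trans (s≤s (s≤s (s≤s z≤n))) 4≤m))
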